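{- There is an absolute constant $C>0$ such that for every integer $n\geqslant 3$ and every regular $n$-gon $P$ in $\mathbb{R}^2$, the extension complexity of $P$ satisfies $\mathrm{xc}(P)\leqslant C\log n$. (In other words, $\mathrm{xc}(P)=O(\log n)$ for a regular $n$-gon $P$ in $\mathbb{R}^2$.)
   Context: A polytope is the convex hull of finitely many points in some $\mathbb{R}^d$. An extension of a polytope $P\subseteq\mathbb{R}^d$ is a polytope $Q\subseteq\mathbb{R}^e$ (for some $e$) such that $P$ is the image of $Q$ under a linear projection $\mathbb{R}^e\to\mathbb{R}^d$. The size of an extension $Q$ is its number of facets. The extension complexity $\mathrm{xc}(P)$ is the minimum size of an extension of $P$. An $n$-gon is a convex polygon with $n$ vertices. -}

module Defs where

open import Algebra.Bundles using (CommutativeRing)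
import Algebra.Properties.Semiring.Sum as SemiringSum
open import Data.Fin.Base using (Fin; toℕ)
open import Data.Nat.Base as ℕ using (ℕ; zero; suc)
open import Data.Nat.DivMod using (_mod_)
open import Data.Product.Base using (Σ; ∃; ∃-syntax; _×_; _,_; swap)
open import Data.Vec.Functional using (Vector)
import Data.Vec.Functional.Relation.Binary.Equality.Setoid as VectorEquality
open import Function.Bundles using (Bijection)
open import Level using (0ℓ)
open import Relation.Binary.Bundles using (Setoid)
open import Relation.Binary.Core using (Rel)
import Relation.Binary.Construct.NonStrictToStrict as ToStrict
open import Relation.Binary.Structures using (IsTotalOrder)
open import Relation.Binary.PropositionalEquality.Core using (_≢_)
import Relation.Binary.PropositionalEquality.Properties as ≡
open import Relation.Nullary.Negation.Core using (¬_)
open import Relation.Unary using (Pred; _∈_; _⊆_; _≐_; Satisfiable)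

-- The real numbers, axiomatised as a Dedekind-complete totally ordered field.
-- In the presence of excluded middle this determines them up to isomorphism.
record Reals : Set₁ where
  field
    commutativeRing : CommutativeRing 0ℓ 0ℓ

  open CommutativeRing commutativeRing public

  infix 4 _≤_
  field
    _≤_          : Rel Carrier 0ℓ
    isTotalOrder : IsTotalOrder _≈_ _≤_
    0≉1          : ¬ 0# ≈ 1#
    inverse      : ∀ x → ¬ x ≈ 0# → ∃[ y ] x * y ≈ 1#
    +-monoˡ-≤    : ∀ z {x y} → x ≤ y → x + z ≤ y + z
    *-nonneg     : ∀ {x y} → 0# ≤ x → 0# ≤ y → 0# ≤ x * y

  IsUpperBound : Pred Carrier 0ℓ → Pred Carrier 0ℓ
  IsUpperBound S b = ∀ {x} → x ∈ S → x ≤ b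

  field
    supremum : (S : Pred Carrier 0ℓ) →
               Satisfiable S → Satisfiable (IsUpperBound S) →
               ∃[ s ] (IsUpperBound S s × (∀ {b} → IsUpperBound S b → s ≤ b))

  open ToStrict _≈_ _≤_ public using (_<_)
  open SemiringSum semiring public using (sum)

-- Cyclic successor: next i = i + 1 modulo n.
next : ∀ {n} → Fin n → Fin n
next {suc n} i = suc (toℕ i) mod suc n

module _ (R : Reals) where
  open Reals R
  open VectorEquality setoid using (_≋_)

  Point : ℕ → Set
  Point d = Vector Carrier d

  infix 7 _·_
  _·_ : ∀ {d} → Point d → Point d → Carrier
  x · y = sum (λ j → x j * y j)

  infixl 6 _⊖_
  _⊖_ : ∀ {d} → Point d → Point d → Point d
  (x ⊖ y) j = x j - y j

  combination : ∀ {k d} → Vector Carrier k → Vector (Point d) k → Point d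
  combination c v j = sum (λ i → c i * v i j)

  ConvexHull : ∀ {k d} → Vector (Point d) k → Pred (Point d) 0ℓ
  ConvexHull v x = ∃[ c ] ((∀ i → 0# ≤ c i) × sum c ≈ 1# × combination c v ≋ x)

  -- A polytope is presented by a finite family of points spanning it; the
  -- family need not be irredundant.  The polytope itself is the set ⟦ P ⟧.
  record Polytope (d : ℕ) : Set where
    field
      {count}    : ℕ
      generators : Vector (Point d) count

  ⟦_⟧ : ∀ {d} → Polytope d → Pred (Point d) 0ℓ
  ⟦ P ⟧ = ConvexHull (Polytope.generators P)

  AffinelyIndependent : ∀ {k d} → Vector (Point d) k → Set
  AffinelyIndependent v =
    ∀ c → sum c ≈ 0# → combination c v ≋ (λ _ → 0#) → ∀ i → c i ≈ 0#

  -- The affine dimension of S is r - 1 (so r = 0 for the empty set, whose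
  -- dimension is -1).
  HasDimension+1 : ∀ {d} → Pred (Point d) 0ℓ → ℕ → Set
  HasDimension+1 {d} S r =
    (∃[ v ] ((∀ (i : Fin r) → v i ∈ S) × AffinelyIndependent v)) ×
    (∀ {k} (v : Vector (Point d) k) →
       (∀ i → v i ∈ S) → AffinelyIndependent v → k ℕ.≤ r)

  -- A face is cut out by equality in a valid linear inequality; a facet is a
  -- face whose dimension is one less than that of the polytope.
  record Facet {d} (Q : Polytope d) : Set where
    field
      normal : Point d
      offset : Carrier
      valid  : ∀ {x} → x ∈ ⟦ Q ⟧ → normal · x ≤ offset

    face : Pred (Point d) 0ℓ
    face x = x ∈ ⟦ Q ⟧ × normal · x ≈ offset

    field
      {faceRank}        : ℕ
      face-dimension    : HasDimension+1 face faceRank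
      ambient-dimension : HasDimension+1 ⟦ Q ⟧ (suc faceRank)

  -- Facets are identified when they are the same set of points: different
  -- inequalities may define the same facet.
  facetSetoid : ∀ {d} → Polytope d → Setoid 0ℓ 0ℓ
  facetSetoid Q = record
    { Carrier       = Facet Q
    ; _≈_           = λ F G → Facet.face F ≐ Facet.face G
    ; isEquivalence = record
      { refl  = (λ x∈F → x∈F) , (λ x∈F → x∈F)
      ; sym   = swap
      ; trans = λ { (F⊆G , G⊆F) (G⊆H , H⊆G) →
                    (λ x∈F → G⊆H (F⊆G x∈F)) , (λ x∈H → G⊆F (H⊆G x∈H)) }
      }
    }

  HasSize : ∀ {d} → Polytope d → ℕ → Set
  HasSize Q k = Bijection (≡.setoid (Fin k)) (facetSetoid Q)

  -- Linear maps ℝᵉ → ℝᵈ, given by their matrices.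
  LinearMap : ℕ → ℕ → Set
  LinearMap e d = Vector (Point e) d

  apply : ∀ {e d} → LinearMap e d → Point e → Point d
  apply π x i = π i · x

  Image : ∀ {e d} → LinearMap e d → Pred (Point e) 0ℓ → Pred (Point d) 0ℓ
  Image π S y = ∃[ x ] (x ∈ S × apply π x ≋ y)

  IsExtension : ∀ {e d} → Polytope e → Polytope d → Set
  IsExtension Q P = ∃[ π ] ⟦ P ⟧ ≐ Image π ⟦ Q ⟧

  HasExtensionOfSize : ∀ {d} → Polytope d → ℕ → Set
  HasExtensionOfSize P k =
    ∃[ e ] Σ (Polytope e) λ Q → IsExtension Q P × HasSize Q k

  IsExtensionComplexity : ∀ {d} → Polytope d → ℕ → Set
  IsExtensionComplexity P m =
    HasExtensionOfSize P m × (∀ {k} → HasExtensionOfSize P k → m ℕ.≤ k)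

  cross : Point 2 → Point 2 → Carrier
  cross u v = u 0F * v 1F - u 1F * v 0F
    where open import Data.Fin.Patterns using (0F; 1F)

  -- p lists the n vertices of a convex polygon counterclockwise: every other
  -- vertex lies strictly to the left of each directed edge from p i to
  -- p (next i).
  IsConvexPolygon : ∀ {n} → Vector (Point 2) n → Set
  IsConvexPolygon p = ∀ i j → j ≢ i → j ≢ next i →
    0# < cross (p (next i) ⊖ p i) (p j ⊖ p i)

  -- The angle between u and v has cosine c; here s is the product of the
  -- lengths of u and v.
  HasCosine : ∀ {d} → Point d → Point d → Carrier → Set
  HasCosine u v c =
    ∃[ s ] (0# ≤ s × s * s ≈ (u · u) * (v · v) × u · v ≈ c * s)

  IsEquilateral : ∀ {n} → Vector (Point 2) n → Set
  IsEquilateral p = ∃[ ℓ² ] (∀ i →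
    let edge = p (next i) ⊖ p i in edge · edge ≈ ℓ²)

  -- Angles of a convex polygon lie between 0 and π, where the cosine is
  -- injective.
  IsEquiangular : ∀ {n} → Vector (Point 2) n → Set
  IsEquiangular p = ∃[ c ] (∀ i →
    HasCosine (p i ⊖ p (next i)) (p (next (next i)) ⊖ p (next i)) c)

  IsRegularPolygon : ℕ → Polytope 2 → Set
  IsRegularPolygon n P = Σ (Vector (Point 2) n) λ p →
    IsConvexPolygon p × IsEquilateral p × IsEquiangular p ×
    ⟦ P ⟧ ≐ ConvexHull p

{-# OPTIONS --safe #-}
module Submission where

-- Let v₀, …, vₙ₋₁ be the vertices in order and A k the convex hull of the first
-- k of them.  The reflection exchanging v₀ and vₖ₋₁ exchanges vᵢ and vₖ₋₁₋ᵢ, so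
-- A k is the hull of A ⌈k/2⌉ and its mirror image.  If A ⌈k/2⌉ is the image of
-- Q, then A k is the image of {(t , x) | x ∈ Q, 0 ≤ t ≤ l x}, where l is the
-- affine function for which the reflection maps the image y of x to y + l x a,
-- with a = vₖ₋₁ - v₀.  This takes two more inequalities, so A n = P is reached
-- from a point with 2 ⌈log₂ n⌉ of them.  A facet is cut out by one of the
-- inequalities, hence there are no more facets than inequalities.

-- The argument is exact algebra, without angles or square roots. Regularity enters as a number ω =
-- α + i β that multiplies each edge into the next: equal lengths and equal cosines fix α and β²,
-- and convexity makes β positive. Hence ω ≠ 1 and the rotation has a centre. A reflection that
-- exchanges two vertices and fixes the centre inverts the rotation, so it matches all the vertices
-- in between. What needs care is the sign of l. Only if l ≥ 0 on the first half is the hull of the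
-- bottom and top copies of Q cut out by 0 ≤ t ≤ l x, and this sign comes from the convexity of the
-- polygon. The facet bound allows one inequality beyond those of the lift, because under the
-- definition of a facet the empty set is a facet of a single point. With 1 + ⌊log₂ n⌋ as a bound on
-- the number of halvings, the size is at most 3 + 2 ⌊log₂ n⌋, which gives the constant 5.

open import Defs
open import Axiom.ExcludedMiddle using (ExcludedMiddle)
open import Data.Nat.Logarithm using (⌊log₂_⌋; ⌊log₂⌋-mono-≤; ⌊log₂[2^n]⌋≡n)
open import Data.Product.Base using (Σ; ∃-syntax; _×_; _,_; proj₁; proj₂)
open import Level using (0ℓ)

open import Algebra.Bundles using (CommutativeRing; RawRing)
import Algebra.Properties.AbelianGroup as AbelianGroupProperties
import Algebra.Properties.CommutativeSemigroup as CommutativeSemigroupProperties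
import Algebra.Properties.Ring as RingProperties
import Algebra.Properties.Semiring.Mult.TCOptimised as Multiples
import Algebra.Properties.Semiring.Sum as SemiringSum
import Algebra.Solver.Ring as RingSolver
open import Algebra.Solver.Ring.AlmostCommutativeRing
  using (_-Raw-AlmostCommutative⟶_; fromCommutativeRing)
open import Data.Fin.Base as Fin using (Fin; zero; suc)
open import Data.Fin.Patterns using (0F; 1F; 2F)
import Data.Fin.Properties as Finₚ
open import Data.Maybe.Base using (Maybe; just; nothing)
open import Data.Nat.Base as ℕ using (ℕ; zero; suc)
open import Data.Nat.DivMod
  using (_mod_; _%_; m%n<n; m<n⇒m%n≡m; [m+n]%n≡m%n; m%n%n≡m%n; %-distribˡ-+)
import Data.Nat.Properties as ℕₚ
open import Data.Product.Properties using (≡-dec)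
open import Data.Sum.Base as Sum using (_⊎_; inj₁; inj₂)
open import Data.Vec.Functional as Vector using (Vector)
import Data.Vec.Functional.Properties as Vectorₚ
import Data.Vec.Functional.Relation.Unary.All.Properties as Allₚ
open import Function.Base using (_∘_; case_of_)
open import Function.Bundles using (Bijection)
open import Relation.Binary.Bundles using (Setoid)
open import Relation.Binary.PropositionalEquality.Core as ≡ using (_≡_; _≢_)
import Relation.Binary.PropositionalEquality.Properties as ≡
import Relation.Binary.Reasoning.Setoid as SetoidReasoning
open import Relation.Binary.Structures using (IsTotalOrder)
open import Relation.Nullary.Decidable.Core using (yes; no)
open import Relation.Nullary.Negation.Core using (¬_; contradiction)
open import Relation.Unary using (Pred; _∈_; _⊆_; _≐_)

-- Normalising polynomial identities over an abstract commutative ring.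

-- The coefficients of the solver are formal differences (m , n) of natural
-- numbers, so that it recognises cancellation in an abstract ring.  They are
-- kept reduced because the solver compares normal forms syntactically.
module DifferenceCoefficients (A : CommutativeRing 0ℓ 0ℓ) where
  open CommutativeRing A hiding (zero)
  open Multiples semiring renaming (_×_ to _⊗_)
  open RingProperties ring using (-‿distribˡ-*; -‿distribʳ-*)
  open AbelianGroupProperties +-abelianGroup using (⁻¹-∙-comm; ε⁻¹≈ε; ⁻¹-anti-homo‿-; ⁻¹-involutive)
  open CommutativeSemigroupProperties +-commutativeSemigroup using (interchange)
  open SetoidReasoning setoid

  reduce : ℕ → ℕ → ℕ × ℕ
  reduce (suc a) (suc b) = reduce a b
  reduce zero    b       = zero , b
  reduce (suc a) zero    = suc a , zero

  differenceRing : RawRing 0ℓ 0ℓ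
  differenceRing = record
    { Carrier = ℕ × ℕ
    ; _≈_     = _≡_
    ; _+_     = λ (a , b) (c , d) → reduce (a ℕ.+ c) (b ℕ.+ d)
    ; _*_     = λ (a , b) (c , d) → reduce (a ℕ.* c ℕ.+ b ℕ.* d) (a ℕ.* d ℕ.+ b ℕ.* c)
    ; -_      = λ (a , b) → b , a
    ; 0#      = 0 , 0
    ; 1#      = 1 , 0
    }

  ⟦_⟧ᵈ : ℕ × ℕ → Carrier
  ⟦ a , zero  ⟧ᵈ = a ⊗ 1#
  ⟦ a , suc b ⟧ᵈ = a ⊗ 1# - suc b ⊗ 1#

  ⟦⟧ᵈ-difference : ∀ a b → ⟦ a , b ⟧ᵈ ≈ a ⊗ 1# - b ⊗ 1#
  ⟦⟧ᵈ-difference a zero    = sym (trans (+-congˡ ε⁻¹≈ε) (+-identityʳ _))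
  ⟦⟧ᵈ-difference a (suc b) = refl

  ⟦reduce⟧ᵈ : ∀ a b → ⟦ reduce a b ⟧ᵈ ≈ a ⊗ 1# - b ⊗ 1#
  ⟦reduce⟧ᵈ zero    b       = ⟦⟧ᵈ-difference zero b
  ⟦reduce⟧ᵈ (suc a) zero    = ⟦⟧ᵈ-difference (suc a) zero
  ⟦reduce⟧ᵈ (suc a) (suc b) = begin
    ⟦ reduce a b ⟧ᵈ                         ≈⟨ ⟦reduce⟧ᵈ a b ⟩
    a ⊗ 1# - b ⊗ 1#                         ≈⟨ +-identityˡ _ ⟨
    0# + (a ⊗ 1# - b ⊗ 1#)                  ≈⟨ +-congʳ (-‿inverseʳ 1#) ⟨
    (1# - 1#) + (a ⊗ 1# - b ⊗ 1#)           ≈⟨ interchange _ _ _ _ ⟩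
    (1# + a ⊗ 1#) + (- 1# - b ⊗ 1#)         ≈⟨ +-congˡ (⁻¹-∙-comm _ _) ⟩
    (1# + a ⊗ 1#) - (1# + b ⊗ 1#)           ≈⟨ +-cong (1+× a 1#) (-‿cong (1+× b 1#)) ⟨
    suc a ⊗ 1# - suc b ⊗ 1#                 ∎

  ⟦⟧ᵈ-+ : ∀ x y → ⟦ RawRing._+_ differenceRing x y ⟧ᵈ ≈ ⟦ x ⟧ᵈ + ⟦ y ⟧ᵈ
  ⟦⟧ᵈ-+ (a , b) (c , d) = begin
    ⟦ reduce (a ℕ.+ c) (b ℕ.+ d) ⟧ᵈ           ≈⟨ ⟦reduce⟧ᵈ (a ℕ.+ c) (b ℕ.+ d) ⟩
    (a ℕ.+ c) ⊗ 1# - (b ℕ.+ d) ⊗ 1#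
      ≈⟨ +-cong (×-homo-+ 1# a c) (-‿cong (×-homo-+ 1# b d)) ⟩
    (a ⊗ 1# + c ⊗ 1#) - (b ⊗ 1# + d ⊗ 1#)     ≈⟨ +-congˡ (⁻¹-∙-comm _ _) ⟨
    (a ⊗ 1# + c ⊗ 1#) + (- (b ⊗ 1#) - d ⊗ 1#) ≈⟨ interchange _ _ _ _ ⟩
    (a ⊗ 1# - b ⊗ 1#) + (c ⊗ 1# - d ⊗ 1#)     ≈⟨ +-cong (⟦⟧ᵈ-difference a b) (⟦⟧ᵈ-difference c d) ⟨
    ⟦ a , b ⟧ᵈ + ⟦ c , d ⟧ᵈ                    ∎

  ⟦⟧ᵈ-neg : ∀ x → ⟦ RawRing.-_ differenceRing x ⟧ᵈ ≈ - ⟦ x ⟧ᵈ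
  ⟦⟧ᵈ-neg (a , b) = begin
    ⟦ b , a ⟧ᵈ            ≈⟨ ⟦⟧ᵈ-difference b a ⟩
    b ⊗ 1# - a ⊗ 1#       ≈⟨ ⁻¹-anti-homo‿- _ _ ⟨
    - (a ⊗ 1# - b ⊗ 1#)   ≈⟨ -‿cong (⟦⟧ᵈ-difference a b) ⟨
    - ⟦ a , b ⟧ᵈ          ∎

  difference-product : ∀ x y u v → (x - y) * (u - v) ≈ (x * u + y * v) - (x * v + y * u)
  difference-product x y u v = begin
    (x - y) * (u - v)                         ≈⟨ distribʳ _ _ _ ⟩
    x * (u - v) + - y * (u - v)               ≈⟨ +-cong (distribˡ _ _ _) (distribˡ _ _ _) ⟩
    (x * u + x * - v) + (- y * u + - y * - v) ≈⟨ +-congˡ (+-comm _ _) ⟩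
    (x * u + x * - v) + (- y * - v + - y * u) ≈⟨ interchange _ _ _ _ ⟩
    (x * u + - y * - v) + (x * - v + - y * u)
      ≈⟨ +-cong (+-congˡ negneg) (+-cong (sym (-‿distribʳ-* x v)) (sym (-‿distribˡ-* y u))) ⟩
    (x * u + y * v) + (- (x * v) - y * u)     ≈⟨ +-congˡ (⁻¹-∙-comm _ _) ⟩
    (x * u + y * v) - (x * v + y * u)         ∎
    where
    negneg : - y * - v ≈ y * v
    negneg = trans (sym (-‿distribˡ-* y (- v)))
      (trans (-‿cong (sym (-‿distribʳ-* y v))) (⁻¹-involutive _))

  ⟦⟧ᵈ-* : ∀ x y → ⟦ RawRing._*_ differenceRing x y ⟧ᵈ ≈ ⟦ x ⟧ᵈ * ⟦ y ⟧ᵈ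
  ⟦⟧ᵈ-* (a , b) (c , d) = begin
    ⟦ reduce (a ℕ.* c ℕ.+ b ℕ.* d) (a ℕ.* d ℕ.+ b ℕ.* c) ⟧ᵈ
      ≈⟨ ⟦reduce⟧ᵈ (a ℕ.* c ℕ.+ b ℕ.* d) (a ℕ.* d ℕ.+ b ℕ.* c) ⟩
    (a ℕ.* c ℕ.+ b ℕ.* d) ⊗ 1# - (a ℕ.* d ℕ.+ b ℕ.* c) ⊗ 1#
      ≈⟨ +-cong (expand a c b d) (-‿cong (expand a d b c)) ⟩
    ((a ⊗ 1#) * (c ⊗ 1#) + (b ⊗ 1#) * (d ⊗ 1#)) - ((a ⊗ 1#) * (d ⊗ 1#) + (b ⊗ 1#) * (c ⊗ 1#))
      ≈⟨ difference-product _ _ _ _ ⟨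
    (a ⊗ 1# - b ⊗ 1#) * (c ⊗ 1# - d ⊗ 1#)
      ≈⟨ *-cong (⟦⟧ᵈ-difference a b) (⟦⟧ᵈ-difference c d) ⟨
    ⟦ a , b ⟧ᵈ * ⟦ c , d ⟧ᵈ ∎
    where
    expand : ∀ k l m n → (k ℕ.* l ℕ.+ m ℕ.* n) ⊗ 1# ≈ (k ⊗ 1#) * (l ⊗ 1#) + (m ⊗ 1#) * (n ⊗ 1#)
    expand k l m n = trans (×-homo-+ 1# (k ℕ.* l) (m ℕ.* n))
      (+-cong (×1-homo-* k l) (×1-homo-* m n))

  morphism : differenceRing -Raw-AlmostCommutative⟶ fromCommutativeRing A
  morphism = record
    { ⟦_⟧    = ⟦_⟧ᵈ
    ; +-homo = ⟦⟧ᵈ-+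
    ; *-homo = ⟦⟧ᵈ-*
    ; -‿homo = ⟦⟧ᵈ-neg
    ; 0-homo = refl
    ; 1-homo = refl
    }

  coefficient≟ : ∀ x y → Maybe (⟦ x ⟧ᵈ ≈ ⟦ y ⟧ᵈ)
  coefficient≟ x y with ≡-dec ℕₚ._≟_ ℕₚ._≟_ x y
  ... | yes ≡.refl = just refl
  ... | no  _      = nothing

module CommutativeRingSolver (A : CommutativeRing 0ℓ 0ℓ) where
  open DifferenceCoefficients A using (differenceRing; morphism; coefficient≟)
  open RingSolver differenceRing (fromCommutativeRing A) morphism coefficient≟ public
    using (solve; _:=_; con; _:+_; _:*_; _:-_; :-_)

-- Arithmetic in an ordered field.

module OrderedField (em : ExcludedMiddle 0ℓ) (R : Reals) where
  open Reals R hiding (zero)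
  open CommutativeRingSolver commutativeRing
  open IsTotalOrder isTotalOrder public
    using (total)
    renaming (refl to ≤-refl; trans to ≤-trans; antisym to ≤-antisym; reflexive to ≤-reflexive)

  ≤-respˡ : ∀ {x y z} → x ≈ y → x ≤ z → y ≤ z
  ≤-respˡ x≈y = ≤-trans (≤-reflexive (sym x≈y))

  ≤-respʳ : ∀ {x y z} → x ≈ y → z ≤ x → z ≤ y
  ≤-respʳ x≈y z≤x = ≤-trans z≤x (≤-reflexive x≈y)

  <-respʳ : ∀ {x y z} → x ≈ y → z < x → z < y
  <-respʳ x≈y (z≤x , z≉x) = ≤-respʳ x≈y z≤x , λ z≈y → z≉x (trans z≈y (sym x≈y))

  positive⇒nonzero : ∀ {x} → 0# < x → ¬ x ≈ 0#
  positive⇒nonzero (_ , 0≉x) x≈0 = 0≉x (sym x≈0)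

  +-mono-≤ : ∀ {x y u v} → x ≤ y → u ≤ v → x + u ≤ y + v
  +-mono-≤ {x} {y} {u} {v} x≤y u≤v = ≤-trans (+-monoˡ-≤ u x≤y)
    (≤-respˡ (+-comm u y) (≤-respʳ (+-comm v y) (+-monoˡ-≤ y u≤v)))

  +-nonneg : ∀ {x y} → 0# ≤ x → 0# ≤ y → 0# ≤ x + y
  +-nonneg 0≤x 0≤y = ≤-respˡ (+-identityˡ 0#) (+-mono-≤ 0≤x 0≤y)

  x≤y⇒0≤y-x : ∀ {x y} → x ≤ y → 0# ≤ y - x
  x≤y⇒0≤y-x {x} {y} x≤y = ≤-respˡ (-‿inverseʳ x) (+-monoˡ-≤ (- x) x≤y)

  0≤y-x⇒x≤y : ∀ {x y} → 0# ≤ y - x → x ≤ y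
  0≤y-x⇒x≤y {x} {y} 0≤y-x = ≤-respˡ (+-identityˡ x)
    (≤-respʳ (solve 2 (λ x y → y :- x :+ x := y) refl x y) (+-monoˡ-≤ x 0≤y-x))

  x≤0⇒0≤-x : ∀ {x} → x ≤ 0# → 0# ≤ - x
  x≤0⇒0≤-x x≤0 = ≤-respʳ (+-identityˡ _) (x≤y⇒0≤y-x x≤0)

  x<y⇒0<y-x : ∀ {x y} → x < y → 0# < y - x
  x<y⇒0<y-x {x} {y} (x≤y , x≉y) = x≤y⇒0≤y-x x≤y , λ 0≈y-x → x≉y
    (trans (trans (sym (+-identityˡ x)) (+-congʳ 0≈y-x)) (solve 2 (λ x y → y :- x :+ x
      := y) refl x y))

  nonneg-sum-zeroˡ : ∀ {x y} → 0# ≤ x → 0# ≤ y → x + y ≈ 0# → x ≈ 0#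
  nonneg-sum-zeroˡ {x} {y} 0≤x 0≤y x+y≈0 = ≤-antisym
    (≤-respˡ (+-identityʳ x) (≤-respʳ x+y≈0 (+-mono-≤ ≤-refl 0≤y))) 0≤x

  +-nonneg-positive : ∀ {x y} → 0# ≤ x → 0# < y → 0# < x + y
  +-nonneg-positive 0≤x (0≤y , 0≉y) = +-nonneg 0≤x 0≤y ,
    λ 0≈x+y → 0≉y (sym (nonneg-sum-zeroˡ 0≤y 0≤x (trans (+-comm _ _) (sym 0≈x+y))))

  *-cancel-zeroˡ : ∀ {x y} → ¬ x ≈ 0# → x * y ≈ 0# → y ≈ 0#
  *-cancel-zeroˡ {x} {y} x≉0 xy≈0 with inverse x x≉0
  ... | x⁻¹ , xx⁻¹≈1 = begin
    y             ≈⟨ *-identityˡ y ⟨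
    1# * y        ≈⟨ *-congʳ xx⁻¹≈1 ⟨
    x * x⁻¹ * y   ≈⟨ solve 3 (λ x i y → x :* i :* y := i :* (x :* y)) refl x x⁻¹ y ⟩
    x⁻¹ * (x * y) ≈⟨ *-congˡ xy≈0 ⟩
    x⁻¹ * 0#      ≈⟨ zeroʳ x⁻¹ ⟩
    0#            ∎
    where open SetoidReasoning setoid

  *-positive : ∀ {x y} → 0# < x → 0# < y → 0# < x * y
  *-positive 0<x@(0≤x , _) 0<y@(0≤y , _) = *-nonneg 0≤x 0≤y ,
    λ 0≈xy → positive⇒nonzero 0<y (*-cancel-zeroˡ (positive⇒nonzero 0<x) (sym 0≈xy))

  square-nonneg : ∀ x → 0# ≤ x * x
  square-nonneg x with total 0# x
  ... | inj₁ 0≤x = *-nonneg 0≤x 0≤x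
  ... | inj₂ x≤0 = ≤-respʳ (solve 1 (λ x → :- x :* :- x := x :* x) refl x)
    (*-nonneg (x≤0⇒0≤-x x≤0) (x≤0⇒0≤-x x≤0))

  0<1 : 0# < 1#
  0<1 = ≤-respʳ (*-identityˡ 1#) (square-nonneg 1#) , 0≉1

  -- By totality the alternative is y ≤ 0, which would make the product nonpositive. This is how
  -- signs are later carried from one vertex to the next.
  positive-factor : ∀ {x y} → 0# ≤ x → 0# < x * y → 0# < y
  positive-factor {x} {y} 0≤x (0≤xy , 0≉xy) with total 0# y
  ... | inj₁ 0≤y = 0≤y , λ 0≈y → 0≉xy (sym (trans (*-congˡ (sym 0≈y)) (zeroʳ x)))
  ... | inj₂ y≤0 = contradiction (≤-antisym 0≤xy xy≤0) 0≉xy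
    where
    xy≤0 : x * y ≤ 0#
    xy≤0 = 0≤y-x⇒x≤y (≤-respʳ (solve 2 (λ x y → x :* :- y := con (0 , 0) :- x :* y) refl x y)
      (*-nonneg 0≤x (x≤0⇒0≤-x y≤0)))

  reciprocal : ∀ {x} → 0# < x → ∃[ y ] (0# < y × x * y ≈ 1#)
  reciprocal {x} 0<x with inverse x (positive⇒nonzero 0<x)
  ... | y , xy≈1 = y , positive-factor (proj₁ 0<x) (<-respʳ (sym xy≈1) 0<1) , xy≈1

  x-y≈0⇒x≈y : ∀ {x y} → x - y ≈ 0# → x ≈ y
  x-y≈0⇒x≈y {x} {y} eq = trans (solve 2 (λ x y → x := x :- y :+ y) refl x y)
    (trans (+-congʳ eq) (+-identityˡ y))

  -- Takes the place of square roots: lengths and sines are identified by their squares and their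
  -- sign. The factorisation of x² - y² settles every case but x + y = 0, where both numbers vanish.
  square-injective : ∀ {x y} → 0# ≤ x → 0# ≤ y → x * x ≈ y * y → x ≈ y
  square-injective {x} {y} 0≤x 0≤y x²≈y² with em {x + y ≈ 0#}
  ... | yes x+y≈0 = trans (nonneg-sum-zeroˡ 0≤x 0≤y x+y≈0)
    (sym (nonneg-sum-zeroˡ 0≤y 0≤x (trans (+-comm y x) x+y≈0)))
  ... | no  x+y≉0 = x-y≈0⇒x≈y (*-cancel-zeroˡ x+y≉0
    (trans (solve 2 (λ x y → (x :+ y) :* (x :- y) := x :* x :- y :* y) refl x y)
           (trans (+-congʳ x²≈y²) (-‿inverseʳ _))))

  square≈0⇒≈0 : ∀ {x} → x * x ≈ 0# → x ≈ 0#
  square≈0⇒≈0 {x} x²≈0 with em {x ≈ 0#}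
  ... | yes x≈0 = x≈0
  ... | no  x≉0 = *-cancel-zeroˡ x≉0 x²≈0

  nonneg∧≉0⇒positive : ∀ {x} → 0# ≤ x → ¬ x ≈ 0# → 0# < x
  nonneg∧≉0⇒positive 0≤x x≉0 = 0≤x , x≉0 ∘ sym

-- Convex sets and convex hulls.

module Convexity (em : ExcludedMiddle 0ℓ) (R : Reals) where
  open Reals R hiding (zero)
  open CommutativeRingSolver commutativeRing
  open OrderedField em R
  open SemiringSum semiring using (sum-cong-≋; ∑-distrib-+; *-distribˡ-sum)
  open SetoidReasoning setoid

  infix 8 _∙_
  _∙_ : ∀ {d} → Point R d → Point R d → Carrier
  _∙_ = _·_ R

  infix 4 _≋_
  _≋_ : ∀ {d} → Point R d → Point R d → Set
  x ≋ y = ∀ j → x j ≈ y j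

  Hull : ∀ {k d} → Vector (Point R d) k → Pred (Point R d) 0ℓ
  Hull = ConvexHull R

  sum-linear : ∀ {n} s t (f g h : Vector Carrier n) → (∀ i → h i ≈ s * f i + t * g i) →
               sum h ≈ s * sum f + t * sum g
  sum-linear s t f g h h≈ = begin
    sum h                                                  ≈⟨ sum-cong-≋ h≈ ⟩
    sum (λ i → s * f i + t * g i)
      ≈⟨ ∑-distrib-+ (λ i → s * f i) (λ i → t * g i) ⟩
    sum (λ i → s * f i) + sum (λ i → t * g i)
      ≈⟨ +-cong (*-distribˡ-sum s f) (*-distribˡ-sum t g) ⟨
    s * sum f + t * sum g                                  ∎

  ∙-linearʳ : ∀ {d} s t (f : Point R d) {x y z} → (∀ j → z j ≈ s * x j + t * y j) →
              f ∙ z ≈ s * (f ∙ x) + t * (f ∙ y)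
  ∙-linearʳ s t f {x} {y} {z} z≈ = sum-linear s t (λ j → f j * x j) (λ j → f j * y j) _ λ j →
    trans (*-congˡ (z≈ j)) (solve 5 (λ s t f x y → f :* (s :* x :+ t :* y)
      := s :* (f :* x) :+ t :* (f :* y))
      refl s t (f j) (x j) (y j))

  ∙-comm : ∀ {d} (x y : Point R d) → x ∙ y ≈ y ∙ x
  ∙-comm x y = sum-cong-≋ (λ j → *-comm (x j) (y j))

  ∙-congʳ : ∀ {d} (f : Point R d) {x y} → x ≋ y → f ∙ x ≈ f ∙ y
  ∙-congʳ f x≋y = sum-cong-≋ (λ j → *-congˡ (x≋y j))

  -- Allowing any `z` pointwise equal to the combination builds invariance under `≋` into convexity,
  -- as `convex-resp` extracts.
  Convex : ∀ {d} → Pred (Point R d) 0ℓ → Set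
  Convex S = ∀ {x y z} s t → 0# ≤ s → 0# ≤ t → s + t ≈ 1# → x ∈ S → y ∈ S →
             (∀ j → z j ≈ s * x j + t * y j) → z ∈ S

  convex-resp : ∀ {d} {S : Pred (Point R d) 0ℓ} → Convex S → ∀ {x y} → x ≋ y → x ∈ S → y ∈ S
  convex-resp convex {x} x≋y x∈S = convex 1# 0# (proj₁ 0<1) ≤-refl (+-identityʳ 1#) x∈S x∈S λ j →
    trans (sym (x≋y j)) (solve 1 (λ x → x := con (1 , 0) :* x :+ con (0 , 0) :* x) refl (x j))

  hull-convex : ∀ {k d} (v : Vector (Point R d) k) → Convex (Hull v)
  hull-convex v {x} {y} {z} s t 0≤s 0≤t s+t≈1 (c , c≥0 , Σc≈1 , c·v≈x) (c′ , c′≥0 , Σc′≈1 ,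
    c′·v≈y) z≈ =
    (λ i → s * c i + t * c′ i) ,
    (λ i → +-nonneg (*-nonneg 0≤s (c≥0 i)) (*-nonneg 0≤t (c′≥0 i))) ,
    (begin
      sum (λ i → s * c i + t * c′ i) ≈⟨ sum-linear s t c c′ _ (λ _ → refl) ⟩
      s * sum c + t * sum c′
        ≈⟨ +-cong (trans (*-congˡ Σc≈1) (*-identityʳ s)) (trans (*-congˡ Σc′≈1) (*-identityʳ t)) ⟩
      s + t                          ≈⟨ s+t≈1 ⟩
      1#                             ∎) ,
    λ j → begin
      sum (λ i → (s * c i + t * c′ i) * v i j)
        ≈⟨ sum-linear s t (λ i → c i * v i j) (λ i → c′ i * v i j) _ (λ i →
             solve 5 (λ s t c c′ v → (s :* c :+ t :* c′) :* v := s :* (c :* v) :+ t :* (c′ :* v))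
               refl s t (c i) (c′ i) (v i j)) ⟩
      s * sum (λ i → c i * v i j) + t * sum (λ i → c′ i * v i j)
        ≈⟨ +-cong (*-congˡ (c·v≈x j)) (*-congˡ (c′·v≈y j)) ⟩
      s * x j + t * y j ≈⟨ z≈ j ⟨
      z j ∎

  sum-nonneg : ∀ {k} (c : Vector Carrier k) → (∀ i → 0# ≤ c i) → 0# ≤ sum c
  sum-nonneg {zero}  c c≥0 = ≤-refl
  sum-nonneg {suc k} c c≥0 = +-nonneg (c≥0 zero) (sum-nonneg (c ∘ suc) (c≥0 ∘ suc))

  sum-zero : ∀ {k} (c : Vector Carrier k) → (∀ i → c i ≈ 0#) → sum c ≈ 0#
  sum-zero {zero}  c c≈0 = refl
  sum-zero {suc k} c c≈0 = trans (+-cong (c≈0 zero) (sum-zero (c ∘ suc) (c≈0 ∘ suc)))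
    (+-identityʳ 0#)

  vertex∈hull : ∀ {k d} (v : Vector (Point R d) k) i → v i ∈ Hull v
  vertex∈hull {suc k} v zero =
    (λ { zero → 1# ; (suc _) → 0# }) ,
    (λ { zero → proj₁ 0<1 ; (suc _) → ≤-refl }) ,
    trans (+-congˡ (sum-zero {k} _ (λ _ → refl))) (+-identityʳ 1#) ,
    λ j → trans (+-cong (*-identityˡ _) (sum-zero {k} _ (λ i → zeroˡ (v (suc i) j))))
      (+-identityʳ _)
  vertex∈hull {suc k} v (suc i) with vertex∈hull (v ∘ suc) i
  ... | c , c≥0 , Σc≈1 , c·v≈ =
    (λ { zero → 0# ; (suc i) → c i }) ,
    (λ { zero → ≤-refl ; (suc i) → c≥0 i }) ,
    trans (+-identityˡ _) Σc≈1 ,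
    λ j → trans (+-cong (zeroˡ _) (c·v≈ j)) (+-identityˡ _)

  -- Partial sums of a convex combination are kept in the form s x with x ∈ S,
  -- where s is the sum of the coefficients so far.
  conic-combination : ∀ {k d} {S : Pred (Point R d) 0ℓ} → Convex S → ∀ {x₀} → x₀ ∈ S →
    (v : Vector (Point R d) k) → (∀ i → v i ∈ S) → (c : Vector Carrier k) → (∀ i → 0# ≤ c i) →
    ∃[ x ] (x ∈ S × (∀ j → combination R c v j ≈ sum c * x j))
  conic-combination {zero} convex {x₀} x₀∈S v v∈S c c≥0 = x₀ , x₀∈S , λ j → sym (zeroˡ (x₀ j))
  conic-combination {suc k} convex {x₀} x₀∈S v v∈S c c≥0
    with conic-combination convex x₀∈S (v ∘ suc) (v∈S ∘ suc) (c ∘ suc) (c≥0 ∘ suc) | em {sum c ≈ 0#}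
  ... | x , x∈S , tail≈ | yes s≈0 = x₀ , x₀∈S , λ j → begin
    c zero * v zero j + combination R (c ∘ suc) (v ∘ suc) j
      ≈⟨ +-cong (*-congʳ c₀≈0) (trans (tail≈ j) (*-congʳ s′≈0)) ⟩
    0# * v zero j + 0# * x j ≈⟨ +-cong (zeroˡ _) (zeroˡ _) ⟩
    0# + 0#                  ≈⟨ +-identityʳ 0# ⟩
    0#                       ≈⟨ zeroˡ _ ⟨
    0# * x₀ j                ≈⟨ *-congʳ s≈0 ⟨
    sum c * x₀ j             ∎
    where
    s′≥0 = sum-nonneg (c ∘ suc) (c≥0 ∘ suc)
    c₀≈0 = nonneg-sum-zeroˡ (c≥0 zero) s′≥0 s≈0
    s′≈0 = nonneg-sum-zeroˡ s′≥0 (c≥0 zero) (trans (+-comm _ _) s≈0)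
  ... | x , x∈S , tail≈ | no s≉0
    with reciprocal (nonneg∧≉0⇒positive (sum-nonneg c c≥0) s≉0)
  ... | i , (0≤i , _) , si≈1 =
    (λ j → (i * c zero) * v zero j + (i * s′) * x j) ,
    convex (i * c zero) (i * s′) (*-nonneg 0≤i (c≥0 zero)) (*-nonneg 0≤i s′≥0)
      (trans (solve 3 (λ i c s → i :* c :+ i :* s := (c :+ s) :* i) refl i (c zero) s′) si≈1)
      (v∈S zero) x∈S (λ _ → refl) ,
    λ j → begin
      c zero * v zero j + combination R (c ∘ suc) (v ∘ suc) j ≈⟨ +-congˡ (tail≈ j) ⟩
      c zero * v zero j + s′ * x j                ≈⟨ *-identityˡ _ ⟨
      1# * (c zero * v zero j + s′ * x j)         ≈⟨ *-congʳ si≈1 ⟨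
      sum c * i * (c zero * v zero j + s′ * x j)
        ≈⟨ solve 6 (λ S i c v s x → S :* i :* (c :* v :+ s :* x)
          := S :* ((i :* c) :* v :+ (i :* s) :* x))
             refl (sum c) i (c zero) (v zero j) s′ (x j) ⟩
      sum c * ((i * c zero) * v zero j + (i * s′) * x j) ∎
    where
    s′   = sum (c ∘ suc)
    s′≥0 = sum-nonneg (c ∘ suc) (c≥0 ∘ suc)

  -- The induction principle for hulls: a property defining a convex set need only be checked on the
  -- generators. An empty family has an empty hull, as its coefficients would sum to 0.
  hull-least : ∀ {k d} {S : Pred (Point R d) 0ℓ} → Convex S → (v : Vector (Point R d) k) →
               (∀ i → v i ∈ S) → Hull v ⊆ S
  hull-least {zero}  convex v v∈S (c , c≥0 , Σc≈1 , c·v≈) = contradiction Σc≈1 0≉1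
  hull-least {suc k} convex v v∈S (c , c≥0 , Σc≈1 , c·v≈x) with conic-combination convex (v∈S zero)
    v v∈S c c≥0
  ... | y , y∈S , c·v≈y = convex-resp convex
    (λ j → trans (sym (trans (*-congʳ Σc≈1) (*-identityˡ (y j))))
      (trans (sym (c·v≈y j)) (c·v≈x j))) y∈S

  halfspace-convex : ∀ {d} (f : Point R d) b → Convex (λ x → b ≤ f ∙ x)
  halfspace-convex f b {x} {y} s t 0≤s 0≤t s+t≈1 b≤x b≤y z≈ = 0≤y-x⇒x≤y (≤-respʳ
    (begin
      s * (f ∙ x - b) + t * (f ∙ y - b)
        ≈⟨ solve 5 (λ s t b u v → s :* (u :- b) :+ t :* (v :- b)
          := (s :* u :+ t :* v) :- (s :+ t) :* b) refl s t b (f ∙ x) (f ∙ y) ⟩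
      (s * (f ∙ x) + t * (f ∙ y)) - (s + t) * b
        ≈⟨ +-cong (sym (∙-linearʳ s t f z≈)) (-‿cong (trans (*-congʳ s+t≈1) (*-identityˡ b))) ⟩
      f ∙ _ - b ∎)
    (+-nonneg (*-nonneg 0≤s (x≤y⇒0≤y-x b≤x)) (*-nonneg 0≤t (x≤y⇒0≤y-x b≤y))))

  hyperplane-convex : ∀ {d} (f : Point R d) b → Convex (λ x → f ∙ x ≈ b)
  hyperplane-convex f b {x} {y} {z} s t 0≤s 0≤t s+t≈1 fx≈b fy≈b z≈ = begin
    f ∙ z                     ≈⟨ ∙-linearʳ s t f z≈ ⟩
    s * (f ∙ x) + t * (f ∙ y) ≈⟨ +-cong (*-congˡ fx≈b) (*-congˡ fy≈b) ⟩
    s * b + t * b             ≈⟨ distribʳ b s t ⟨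
    (s + t) * b               ≈⟨ *-congʳ s+t≈1 ⟩
    1# * b                    ≈⟨ *-identityˡ b ⟩
    b                         ∎

-- Facets of a polytope given by inequalities.

module Facets (em : ExcludedMiddle 0ℓ) (R : Reals) where
  open Reals R hiding (zero)
  open CommutativeRingSolver commutativeRing
  open OrderedField em R
  open Convexity em R
  open SetoidReasoning setoid

  -- A polytope in the hyperplane η ∙ x ≈ 1: inside it every affine
  -- inequality is a homogeneous one.
  record Describes {d N m} (q : Vector (Point R d) N) (η : Point R d) (ν : Vector (Point R d) m) :
    Set where
    field
      height   : ∀ {x} → x ∈ Hull q → η ∙ x ≈ 1#
      bounded  : ∀ {x} → x ∈ Hull q → ∀ i → 0# ≤ ν i ∙ x
      complete : ∀ {x} → η ∙ x ≈ 1# → (∀ i → 0# ≤ ν i ∙ x) → x ∈ Hull q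

  ∙-combination : ∀ {k d} (f : Point R d) {b} (c : Vector Carrier k) (v : Vector (Point R d) k) →
                  (∀ i → f ∙ v i ≈ b) → f ∙ combination R c v ≈ sum c * b
  ∙-combination {zero} f {b} c v fv≈b = trans (sum-zero _ (λ j → zeroʳ (f j))) (sym (zeroˡ b))
  ∙-combination {suc k} f {b} c v fv≈b = begin
    f ∙ combination R c v
      ≈⟨ ∙-linearʳ (c zero) 1# f (λ j → +-congˡ (sym (*-identityˡ _))) ⟩
    c zero * (f ∙ v zero) + 1# * (f ∙ combination R (c ∘ suc) (v ∘ suc))
      ≈⟨ +-cong (*-congˡ (fv≈b zero))
        (trans (*-identityˡ _) (∙-combination f (c ∘ suc) (v ∘ suc) (fv≈b ∘ suc))) ⟩
    c zero * b + sum (c ∘ suc) * b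
      ≈⟨ distribʳ b (c zero) _ ⟨
    sum c * b ∎

  -- Applying `f` to an affine relation and subtracting b times the sum of its coefficients leaves
  -- c₀ (f z - b) = 0, so `z` does not take part.
  affinelyIndependent-∷ : ∀ {k d} {v : Vector (Point R d) k} (f : Point R d) {b z} →
    AffinelyIndependent R v → (∀ i → f ∙ v i ≈ b) → ¬ f ∙ z
      ≈ b → AffinelyIndependent R (z Vector.∷ v)
  affinelyIndependent-∷ {v = v} f {b} {z} v-independent fv≈b fz≉b c Σc≈0 c·zv≈0 = λ
    { zero    → c₀≈0
    ; (suc i) → v-independent (c ∘ suc)
        (trans (sym (trans (+-congʳ c₀≈0) (+-identityˡ _))) Σc≈0)
        (λ j → trans (sym (trans (+-congʳ (trans (*-congʳ c₀≈0) (zeroˡ _))) (+-identityˡ _)))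
          (c·zv≈0 j))
        i
    }
    where
    Σ′ = sum (c ∘ suc)
    c₀≈0 : c zero ≈ 0#
    c₀≈0 = *-cancel-zeroˡ (λ fz-b≈0 → fz≉b (x-y≈0⇒x≈y fz-b≈0)) (begin
      (f ∙ z - b) * c zero
        ≈⟨ solve 4 (λ u b c s → (u :- b) :* c
          := (c :* u :+ con (1 , 0) :* (s :* b)) :- (c :+ s) :* b) refl (f ∙ z) b (c zero) Σ′ ⟩
      (c zero * (f ∙ z) + 1# * (Σ′ * b)) - (c zero + Σ′) * b
        ≈⟨ +-cong (+-congˡ (*-congˡ (sym (∙-combination f (c ∘ suc) v fv≈b))))
          (-‿cong (trans (*-congʳ Σc≈0) (zeroˡ b))) ⟩
      (c zero * (f ∙ z) + 1# * (f ∙ combination R (c ∘ suc) v)) - 0#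
        ≈⟨ +-congʳ (∙-linearʳ (c zero) 1# f (λ j → +-congˡ (sym (*-identityˡ _)))) ⟨
      f ∙ combination R c (z Vector.∷ v) - 0#
        ≈⟨ +-congʳ (trans (∙-congʳ f c·zv≈0) (sum-zero _ (λ j → zeroʳ (f j)))) ⟩
      0# - 0#
        ≈⟨ -‿inverseʳ 0# ⟩
      0# ∎)

  -- Provides the step length in `extrapolate`. The only obstruction would be an index with a = 0 <
  -- b, which the last hypothesis excludes.
  common-scale : ∀ {m} (a b : Vector Carrier m) → (∀ i → 0# ≤ a i) → (∀ i → 0# ≤ b i) →
                 (∀ i → 0# < a i ⊎ b i ≈ 0#) → ∃[ ε ] (0# < ε × (∀ i → ε * b i ≤ a i))
  common-scale {zero} a b a≥0 b≥0 alternative = 1# , 0<1 , λ ()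
  common-scale {suc m} a b a≥0 b≥0 alternative
    with common-scale (a ∘ suc) (b ∘ suc) (a≥0 ∘ suc) (b≥0 ∘ suc) (alternative ∘ suc)
  ... | ε , 0<ε , εb≤a with total (ε * b zero) (a zero) | alternative zero
  ...   | inj₁ εb₀≤a₀ | _ = ε , 0<ε , λ { zero → εb₀≤a₀ ; (suc i) → εb≤a i }
  ...   | inj₂ _ | inj₂ b₀≈0 = ε , 0<ε , λ
    { zero → ≤-respˡ (sym (trans (*-congˡ b₀≈0) (zeroʳ ε))) (a≥0 zero) ; (suc i) → εb≤a i }
  ...   | inj₂ a₀≤εb₀ | inj₁ 0<a₀ with reciprocal 0<b₀
    where
    0<b₀ : 0# < b zero
    0<b₀ = positive-factor (proj₁ 0<ε) (<-≤ 0<a₀ a₀≤εb₀)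
      where
      <-≤ : ∀ {x y} → 0# < x → x ≤ y → 0# < y
      <-≤ (0≤x , 0≉x) x≤y = ≤-trans 0≤x x≤y , λ 0≈y → 0≉x (≤-antisym 0≤x (≤-respʳ (sym 0≈y) x≤y))
  -- The new scale is a₀ / b₀. It is at most ε because a₀ ≤ ε b₀, so it still serves the other
  -- indices.
  ...     | r , 0<r , b₀r≈1 = a zero * r , *-positive 0<a₀ 0<r , λ
    { zero → ≤-reflexive (begin
        a zero * r * b zero
          ≈⟨ solve 3 (λ a r b → a :* r :* b := a :* (b :* r)) refl (a zero) r (b zero) ⟩
        a zero * (b zero * r) ≈⟨ *-congˡ b₀r≈1 ⟩
        a zero * 1#           ≈⟨ *-identityʳ _ ⟩
        a zero                ∎)
    ; (suc i) → ≤-trans (0≤y-x⇒x≤y (≤-respʳ (slack i)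
        (*-nonneg (b≥0 (suc i)) (*-nonneg (proj₁ 0<r) (x≤y⇒0≤y-x a₀≤εb₀))))) (εb≤a i)
    }
    where
    slack : ∀ i → b (suc i) * (r * (ε * b zero - a zero)) ≈ ε * b (suc i) - a zero * r * b (suc i)
    slack i = begin
      b (suc i) * (r * (ε * b zero - a zero))
        ≈⟨ solve 5 (λ b r ε b₀ a → b :* (r :* (ε :* b₀ :- a))
          := (b₀ :* r) :* (ε :* b) :- a :* r :* b)
             refl (b (suc i)) r ε (b zero) (a zero) ⟩
      (b zero * r) * (ε * b (suc i)) - a zero * r * b (suc i)
        ≈⟨ +-congʳ (trans (*-congʳ b₀r≈1) (*-identityˡ _)) ⟩
      ε * b (suc i) - a zero * r * b (suc i) ∎

  half : ∃[ h ] (0# < h × h + h ≈ 1#)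
  half with reciprocal (+-nonneg-positive (proj₁ 0<1) 0<1)
  ... | h , 0<h , 2h≈1 = h , 0<h ,
    trans (solve 1 (λ h → h :+ h := (con (1 , 0) :+ con (1 , 0)) :* h) refl h) 2h≈1

  -- The midpoint of a point slack in the first inequality and a point slack in the others is slack
  -- in all, since no inequality is negative on `S`. `Z` marks the indices exempt from this.
  interior-point : ∀ {m d} {S : Pred (Point R d) 0ℓ} (ν : Vector (Point R d) m) (Z : Fin m → Set) →
    Convex S → (∃[ x ] x ∈ S) → (∀ {x} → x ∈ S → ∀ i → 0# ≤ ν i ∙ x) →
    (∀ i → (∃[ x ] (x ∈ S × 0# < ν i ∙ x)) ⊎ Z i) →
    ∃[ x ] (x ∈ S × (∀ i → 0# < ν i ∙ x ⊎ Z i))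
  interior-point {zero} ν Z convex (x , x∈S) ν≥0 slack = x , x∈S , λ ()
  interior-point {suc m} ν Z convex nonempty ν≥0 slack
    with interior-point (ν ∘ suc) (Z ∘ suc) convex nonempty (λ x∈S →
      ν≥0 x∈S ∘ suc) (slack ∘ suc) | slack zero
  ... | x , x∈S , x-slack | inj₂ z = x , x∈S , λ { zero → inj₂ z ; (suc i) → x-slack i }
  ... | x , x∈S , x-slack | inj₁ (y , y∈S , 0<y) with half
  ...   | h , 0<h@(0≤h , _) , h+h≈1 =
    (λ j → h * x j + h * y j) , convex h h 0≤h 0≤h h+h≈1 x∈S y∈S (λ _ → refl) , λ
    { zero    → inj₁ (<-respʳ (sym (∙-linearʳ h h (ν zero) (λ _ → refl)))
                  (+-nonneg-positive (*-nonneg 0≤h (ν≥0 x∈S zero)) (*-positive 0<h 0<y)))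
    ; (suc i) → case x-slack i of λ
      { (inj₂ z)   → inj₂ z
      ; (inj₁ 0<x) → inj₁ (<-respʳ
            (trans (+-comm _ _) (sym (∙-linearʳ h h (ν (suc i)) (λ _ → refl))))
                       (+-nonneg-positive (*-nonneg 0≤h (ν≥0 y∈S (suc i))) (*-positive 0<h 0<x)))
      }
    }

  module _ {d N m} {q : Vector (Point R d) N} {η : Point R d} {ν : Vector (Point R d) m}
           (describes : Describes q η ν) where
    open Describes describes

    private
      Q : Polytope R d
      Q = record { generators = q }

    -- The inequality 0# ≤ η ∙ x is redundant; its face, the empty set, is the
    -- facet of Q when Q is a single point.
    ν⁺ : Vector (Point R d) (suc m)
    ν⁺ = η Vector.∷ ν

    Section : Fin (suc m) → Pred (Point R d) 0ℓ
    Section i x = x ∈ Hull q × ν⁺ i ∙ x ≈ 0#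

    ν⁺-nonneg : ∀ {x} → x ∈ Hull q → ∀ i → 0# ≤ ν⁺ i ∙ x
    ν⁺-nonneg x∈Q zero    = ≤-respʳ (sym (height x∈Q)) (proj₁ 0<1)
    ν⁺-nonneg x∈Q (suc i) = bounded x∈Q i

    -- Continues the segment from y to x a little beyond x. The weights sum to 1, so the height is
    -- kept, and an inequality with values u at x and v at y takes the value ε u + (u - ε v).
    extrapolate : ∀ {x y} → x ∈ Hull q → y ∈ Hull q → (∀ i → 0# < ν⁺ i ∙ x ⊎ ν⁺ i ∙ y ≈ 0#) →
                  ∃[ ε ] (0# < ε × (λ j → (1# + ε) * x j + - ε * y j) ∈ Hull q)
    extrapolate {x} {y} x∈Q y∈Q alternative
      with common-scale (λ i → ν⁺ i ∙ x) (λ i → ν⁺ i ∙ y) (ν⁺-nonneg x∈Q) (ν⁺-nonneg y∈Q)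
        alternative
    ... | ε , 0<ε , εy≤x = ε , 0<ε , complete
      (begin
        η ∙ (λ j → (1# + ε) * x j + - ε * y j)   ≈⟨ ∙-linearʳ (1# + ε) (- ε) η (λ _ → refl) ⟩
        (1# + ε) * (η ∙ x) + - ε * (η ∙ y)
          ≈⟨ +-cong (*-congˡ (height x∈Q)) (*-congˡ (height y∈Q)) ⟩
        (1# + ε) * 1# + - ε * 1#
          ≈⟨ solve 1 (λ ε → (con (1 , 0) :+ ε) :* con (1 , 0) :+ :- ε :* con (1 , 0)
            := con (1 , 0)) refl ε ⟩
        1# ∎)
      (λ i → ≤-respʳ (sym (∙-linearʳ (1# + ε) (- ε) (ν i) (λ _ → refl)))
        (≤-respʳ (solve 3 (λ ε u v → ε :* u :+ (u :- ε :* v)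
          := (con (1 , 0) :+ ε) :* u :+ :- ε :* v) refl ε (ν i ∙ x) (ν i ∙ y))
          (+-nonneg (*-nonneg (proj₁ 0<ε) (bounded x∈Q i)) (x≤y⇒0≤y-x (εy≤x (suc i))))))

    module _ (F : Facet R Q) where
      open Facet F

      -- An inequality vanishing on all of Q vanishes on every face and singles none out; the
      -- witness `y` rules this out and later supplies an extra dimension.
      Tight : Fin (suc m) → Set
      Tight i = (∃[ y ] (y ∈ Hull q × ¬ ν⁺ i ∙ y ≈ 0#)) × (∀ x → x ∈ face → ν⁺ i ∙ x ≈ 0#)

      face-convex : Convex face
      face-convex s t 0≤s 0≤t s+t≈1 (x∈Q , nx≈) (y∈Q , ny≈) z≈ =
        hull-convex q s t 0≤s 0≤t s+t≈1 x∈Q y∈Q z≈ ,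
        hyperplane-convex normal offset s t 0≤s 0≤t s+t≈1 nx≈ ny≈ z≈

      -- Otherwise an independent family spanning Q would lie in the face, which has room for one
      -- point fewer.
      facet-proper : ∃[ y ] (y ∈ Hull q × ¬ normal ∙ y ≈ offset)
      facet-proper with em {∃[ y ] (y ∈ Hull q × ¬ normal ∙ y ≈ offset)}
      ... | yes proper  = proper
      ... | no improper with ambient-dimension
      ...   | (v , v∈Q , v-independent) , _ =
        contradiction (proj₂ face-dimension v v∈face v-independent) ℕₚ.1+n≰n
        where
        v∈face : ∀ i → v i ∈ face
        v∈face i with em {normal ∙ v i ≈ offset}
        ... | yes tight = v∈Q i , tight
        ... | no  loose = contradiction (v i , v∈Q i , loose) improper

      Slack : Fin (suc m) → Point R d → Set
      Slack i x = 0# < ν⁺ i ∙ x ⊎ (∀ {y} → y ∈ Hull q → ν⁺ i ∙ y ≈ 0#)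

      -- Otherwise x could be moved slightly away from a point of Q outside the
      -- face without leaving Q.
      not-all-slack : ∀ {x} → x ∈ face → ¬ (∀ i → Slack i x)
      not-all-slack {x} (x∈Q , nx≈β) x-slack = proj₂ gap
        (≤-antisym (proj₁ gap) (0≤y-x⇒x≤y (≤-respʳ β-nz≈ (x≤y⇒0≤y-x (valid z∈Q)))))
        where
        y = proj₁ facet-proper
        y∈Q = proj₁ (proj₂ facet-proper)
        alternative : ∀ i → 0# < ν⁺ i ∙ x ⊎ ν⁺ i ∙ y ≈ 0#
        alternative i = Sum.map₂ (λ vanishes → vanishes y∈Q) (x-slack i)
        extrapolated = extrapolate x∈Q y∈Q alternative
        ε = proj₁ extrapolated
        z∈Q = proj₂ (proj₂ extrapolated)
        gap : 0# < ε * (offset - normal ∙ y)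
        gap = *-positive (proj₁ (proj₂ extrapolated))
          (x<y⇒0<y-x (valid y∈Q , proj₂ (proj₂ facet-proper)))
        β-nz≈ : offset - normal ∙ (λ j → (1# + ε) * x j + - ε * y j) ≈
                0# - ε * (offset - normal ∙ y)
        β-nz≈ = begin
          offset - normal ∙ (λ j → (1# + ε) * x j + - ε * y j)
            ≈⟨ +-congˡ (-‿cong (trans (∙-linearʳ (1# + ε) (- ε) normal (λ _ → refl))
              (+-congʳ (*-congˡ nx≈β)))) ⟩
          offset - ((1# + ε) * offset + - ε * (normal ∙ y))
            ≈⟨ solve 3 (λ β ε u → β :- ((con (1 , 0) :+ ε) :* β :+ :- ε :* u)
              := con (0 , 0) :- ε :* (β :- u)) refl offset ε (normal ∙ y) ⟩
          0# - ε * (offset - normal ∙ y) ∎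

      slack-unless-tight : ¬ (∃[ i ] Tight i) → ∀ i →
        (∃[ x ] (x ∈ face × 0# < ν⁺ i ∙ x)) ⊎ (∀ {y} → y ∈ Hull q → ν⁺ i ∙ y ≈ 0#)
      slack-unless-tight loose i with em {∃[ x ] (x ∈ face × 0# < ν⁺ i ∙ x)}
      ... | yes slack = inj₁ slack
      ... | no  none  = inj₂ vanishes
        where
        tight : ∀ x → x ∈ face → ν⁺ i ∙ x ≈ 0#
        tight x x∈F with em {ν⁺ i ∙ x ≈ 0#}
        ... | yes x≈0 = x≈0
        ... | no  x≉0 = contradiction (x , x∈F , nonneg∧≉0⇒positive (ν⁺-nonneg (proj₁ x∈F) i) x≉0)
              none
        vanishes : ∀ {y} → y ∈ Hull q → ν⁺ i ∙ y ≈ 0#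
        vanishes {y} y∈Q with em {ν⁺ i ∙ y ≈ 0#}
        ... | yes y≈0 = y≈0
        ... | no  y≉0 = contradiction (i , (y , y∈Q , y≉0) , tight) loose

      -- Without a tight inequality, each one that does not vanish on Q is positive somewhere on the
      -- face. Averaging these points gives a single one that `not-all-slack` forbids.
      tight-inequality : ∃[ i ] Tight i
      tight-inequality with em {∃[ i ] Tight i} | em {∃[ x ] x ∈ face}
      ... | yes tight | _ = tight
      -- On an empty face every inequality is tight vacuously; `η` is chosen because its value 1
      -- certifies that it does not vanish on Q.
      ... | no  loose | no empty = contradiction
        (zero , (proj₁ facet-proper , y∈Q , λ ηy≈0 → 0≉1 (trans (sym ηy≈0) (height y∈Q))) ,
          λ x x∈F → contradiction (x , x∈F) empty) loose
        where
        y∈Q = proj₁ (proj₂ facet-proper)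
      ... | no  loose | yes nonempty =
            contradiction (proj₂ (proj₂ interior)) (not-all-slack (proj₁ (proj₂ interior)))
        where
        interior : ∃[ x ] (x ∈ face × ∀ i → Slack i x)
        interior = interior-point ν⁺ _ face-convex nonempty (λ x∈F →
          ν⁺-nonneg (proj₁ x∈F)) (slack-unless-tight loose)

      -- A point of the section outside the face would raise the dimension twice
      -- from that of the face to that of Q.
      section⊆face : ∀ {i} → Tight i → Section i ⊆ face
      section⊆face {i} ((y , y∈Q , νy≉0) , tight) {z} (z∈Q , νz≈0) with em {normal ∙ z ≈ offset}
      ... | yes nz≈β = z∈Q , nz≈β
      ... | no  nz≉β = contradiction
        (proj₂ ambient-dimension (y Vector.∷ (z Vector.∷ v)) yzv∈Q
          (affinelyIndependent-∷ (ν⁺ i)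
            (affinelyIndependent-∷ normal v-independent (proj₂ ∘ v∈F) nz≉β) zv-tight νy≉0))
        ℕₚ.1+n≰n
        where
        v = proj₁ (proj₁ face-dimension)
        v∈F = proj₁ (proj₂ (proj₁ face-dimension))
        v-independent = proj₂ (proj₂ (proj₁ face-dimension))
        yzv∈Q : ∀ k → (y Vector.∷ (z Vector.∷ v)) k ∈ Hull q
        yzv∈Q zero          = y∈Q
        yzv∈Q (suc zero)    = z∈Q
        yzv∈Q (suc (suc k)) = proj₁ (v∈F k)
        zv-tight : ∀ k → ν⁺ i ∙ (z Vector.∷ v) k ≈ 0#
        zv-tight zero    = νz≈0
        zv-tight (suc k) = tight (v k) (v∈F k)

      facet-is-section : ∃[ i ] (face ≐ Section i)
      facet-is-section with tight-inequality
      ... | i , i-tight = i , (λ {x} x∈F → proj₁ x∈F , proj₂ i-tight x x∈F) ,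
            section⊆face {i} i-tight

-- Minima and finite enumerations by excluded middle.

module Enumeration (em : ExcludedMiddle 0ℓ) where

  -- A witness below `k` lies within the smaller bound, so the descent is structural in `b`.
  least : (P : Pred ℕ 0ℓ) → ∀ b {k} → k ℕ.≤ b → P k →
          ∃[ m ] (m ℕ.≤ b × P m × (∀ {j} → P j → m ℕ.≤ j))
  least P zero ℕ.z≤n Pk = zero , ℕ.z≤n , Pk , λ _ → ℕ.z≤n
  least P (suc b) {k} k≤b Pk with em {∃[ j ] (j ℕ.< k × P j)}
  ... | no  none = k , k≤b , Pk , λ {j} Pj → ℕₚ.≮⇒≥ (λ j<k → none (j , j<k , Pj))
  ... | yes (j , j<k , Pj) with least P b (ℕ.s≤s⁻¹ (ℕₚ.≤-trans j<k k≤b)) Pj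
  ...   | m , m≤b , rest = m , ℕₚ.m≤n⇒m≤1+n m≤b , rest

  module _ (S : Setoid 0ℓ 0ℓ) where
    open Setoid S

    -- Each index covers at most one class. Its class is added only if it is not yet listed, so
    -- indices that cover nothing or repeat a class make k smaller than M.
    enumerate-covered : ∀ M (Covers : Fin M → Pred Carrier 0ℓ) →
      (∀ {i a b} → Covers i a → Covers i b → a ≈ b) →
      ∃[ k ] (k ℕ.≤ M × Σ (Fin k → Carrier) λ f →
        (∀ {x y} → f x ≈ f y → x ≡ y) × (∀ i {a} → Covers i a → ∃[ x ] f x ≈ a))
    enumerate-covered zero    Covers unique = zero , ℕ.z≤n , (λ ()) , (λ {}) , λ ()
    enumerate-covered (suc M) Covers unique
      with enumerate-covered M (Covers ∘ suc) unique
    ... | k , k≤M , f , f-injective , f-covers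
      with em {∃[ a ] (Covers zero a × (∀ x → ¬ f x ≈ a))}
    ...   | yes (a , a-covered , fresh) = suc k , ℕ.s≤s k≤M , a Vector.∷ f , injective , covers
      where
      injective : ∀ {x y} → (a Vector.∷ f) x ≈ (a Vector.∷ f) y → x ≡ y
      injective {zero}  {zero}  _   = ≡.refl
      injective {zero}  {suc y} a≈f = contradiction (sym a≈f) (fresh y)
      injective {suc x} {zero}  f≈a = contradiction f≈a (fresh x)
      injective {suc x} {suc y} f≈f = ≡.cong suc (f-injective f≈f)
      covers : ∀ i {b} → Covers i b → ∃[ x ] (a Vector.∷ f) x ≈ b
      covers zero    b-covered = zero , unique a-covered b-covered
      covers (suc i) b-covered with f-covers i b-covered
      ... | x , fx≈b = suc x , fx≈b
    ...   | no  none = k , ℕₚ.m≤n⇒m≤1+n k≤M , f , f-injective , covers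
      where
      covers : ∀ i {b} → Covers i b → ∃[ x ] f x ≈ b
      covers zero {b} b-covered with em {∃[ x ] f x ≈ b}
      ... | yes found  = found
      ... | no  absent = contradiction (b , b-covered , λ x fx≈b → absent (x , fx≈b)) none
      covers (suc i) b-covered = f-covers i b-covered

    bijection-from-cover : ∀ M (Covers : Fin M → Pred Carrier 0ℓ) →
      (∀ {i a b} → Covers i a → Covers i b → a ≈ b) → (∀ a → ∃[ i ] Covers i a) →
      ∃[ k ] (k ℕ.≤ M × Bijection (≡.setoid (Fin k)) S)
    bijection-from-cover M Covers unique covered with enumerate-covered M Covers unique
    ... | k , k≤M , f , f-injective , f-covers = k , k≤M , record
      { to        = f
      ; cong      = λ { ≡.refl → refl }
      ; bijective = f-injective , λ a → surjective a
      }
      where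
      surjective : ∀ a → ∃[ x ] (∀ {z} → z ≡ x → f z ≈ a)
      surjective a with covered a
      ... | i , a-covered with f-covers i a-covered
      ...   | x , fx≈a = x , λ { ≡.refl → fx≈a }

-- The number of facets.

module FacetCount (em : ExcludedMiddle 0ℓ) (R : Reals) where
  open Convexity em R
  open Facets em R
  open Enumeration em

  -- Facets that are sections of the same inequality are equal as sets of points. The `suc` counts
  -- the added inequality 0 ≤ η ∙ x.
  facet-count : ∀ {d N m} {q : Vector (Point R d) N} {η : Point R d} {ν : Vector (Point R d) m} →
    Describes q η ν → ∃[ k ] (k ℕ.≤ suc m × HasSize R (record { generators = q }) k)
  facet-count {m = m} {q} describes = bijection-from-cover (facetSetoid R Q) (suc m)
    (λ i F → Facet.face F ≐ Section describes i)
    (λ { (F⊆ , ⊆F) (G⊆ , ⊆G) → (λ {x} x∈F → ⊆G {x} (F⊆ {x} x∈F)) ,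
      (λ {x} x∈G → ⊆F {x} (G⊆ {x} x∈G)) })
    (facet-is-section describes)
    where
    Q : Polytope R _
    Q = record { generators = q }

-- Lifting a polytope over its mirror image.

module Lifting (em : ExcludedMiddle 0ℓ) (R : Reals) where
  open Reals R hiding (zero)
  open CommutativeRingSolver commutativeRing
  open OrderedField em R
  open Convexity em R
  open Facets em R
  open SetoidReasoning setoid

  module _ {d N m} {q : Vector (Point R d) N} {η : Point R d} {ν : Vector (Point R d) m}
           (describes : Describes q η ν) (l : Point R d) (l≥0 : ∀ i → 0# ≤ l ∙ q i) where
    open Describes describes

    -- The polytope {(t , x) | x ∈ Q, 0 ≤ t ≤ l ∙ x}.
    wedge : Vector (Point R (suc d)) (N ℕ.+ N)
    wedge = (λ i → 0# Vector.∷ q i) Vector.++ (λ i → (l ∙ q i) Vector.∷ q i)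

    wedge-height : Point R (suc d)
    wedge-height = 0# Vector.∷ η

    wedge-bounds : Vector (Point R (suc d)) (2 ℕ.+ m)
    wedge-bounds = (1# Vector.∷ λ _ → 0#) Vector.∷ ((- 1# Vector.∷ l) Vector.∷ λ i →
      0# Vector.∷ ν i)

    0∷-∙ : ∀ f t (x : Point R d) → (0# Vector.∷ f) ∙ (t Vector.∷ x) ≈ f ∙ x
    0∷-∙ f t x = trans (+-congʳ (zeroˡ t)) (+-identityˡ _)

    1∷0-∙ : ∀ t (x : Point R d) → (1# Vector.∷ λ _ → 0#) ∙ (t Vector.∷ x) ≈ t
    1∷0-∙ t x = trans (+-cong (*-identityˡ t) (sum-zero _ (λ j → zeroˡ (x j)))) (+-identityʳ t)

    -1∷-∙ : ∀ f t (x : Point R d) → (- 1# Vector.∷ f) ∙ (t Vector.∷ x) ≈ f ∙ x - t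
    -1∷-∙ f t x = solve 2 (λ u t → :- con (1 , 0) :* t :+ u := u :- t) refl (f ∙ x) t

    wedge-bounded : ∀ i {t x} → 0# ≤ t → t ≤ l ∙ x → x ∈ Hull q →
      0# ≤ wedge-bounds i ∙ (t Vector.∷ x)
    wedge-bounded zero          {t} {x} 0≤t t≤lx x∈Q = ≤-respʳ (sym (1∷0-∙ t x)) 0≤t
    wedge-bounded (suc zero)    {t} {x} 0≤t t≤lx x∈Q = ≤-respʳ (sym (-1∷-∙ l t x)) (x≤y⇒0≤y-x t≤lx)
    wedge-bounded (suc (suc i)) {t} {x} 0≤t t≤lx x∈Q =
      ≤-respʳ (sym (0∷-∙ (ν i) t x)) (bounded x∈Q i)

    bottom : ∀ i → wedge (i Fin.↑ˡ N) ≡ 0# Vector.∷ q i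
    bottom = Vectorₚ.lookup-++ˡ (λ i → 0# Vector.∷ q i) (λ i → (l ∙ q i) Vector.∷ q i)

    top : ∀ i → wedge (N Fin.↑ʳ i) ≡ (l ∙ q i) Vector.∷ q i
    top = Vectorₚ.lookup-++ʳ (λ i → 0# Vector.∷ q i) (λ i → (l ∙ q i) Vector.∷ q i)

    -- As x ↦ (0 , x) is linear, the points that it sends into the wedge form a convex set, and the
    -- generators belong to it. The same works for x ↦ (l ∙ x , x) in `top∈wedge`.
    bottom∈wedge : ∀ {x} → x ∈ Hull q → (0# Vector.∷ x) ∈ Hull wedge
    bottom∈wedge = hull-least
      (λ s t 0≤s 0≤t s+t≈1 x∈ y∈ z≈ → hull-convex wedge s t 0≤s 0≤t s+t≈1 x∈ y∈ λ
        { zero → solve 2 (λ s t → con (0 , 0)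
              := s :* con (0 , 0) :+ t :* con (0 , 0)) refl s t ; (suc j) → z≈ j })
      q (λ i → ≡.subst (_∈ Hull wedge) (bottom i) (vertex∈hull wedge (i Fin.↑ˡ N)))

    top∈wedge : ∀ {x} → x ∈ Hull q → ((l ∙ x) Vector.∷ x) ∈ Hull wedge
    top∈wedge = hull-least
      (λ s t 0≤s 0≤t s+t≈1 x∈ y∈ z≈ → hull-convex wedge s t 0≤s 0≤t s+t≈1 x∈ y∈ λ
        { zero → ∙-linearʳ s t l z≈ ; (suc j) → z≈ j })
      q (λ i → ≡.subst (_∈ Hull wedge) (top i) (vertex∈hull wedge (N Fin.↑ʳ i)))

    -- The point (t , x) divides the vertical segment from (0 , x) to (l ∙ x , x) with weights 1 - t
    -- / (l ∙ x) and t / (l ∙ x). If l ∙ x = 0, the segment is a point and t = 0.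
    segment∈wedge : ∀ {t x} → 0# ≤ t → t ≤ l ∙ x → x ∈ Hull q → (t Vector.∷ x) ∈ Hull wedge
    segment∈wedge {t} {x} 0≤t t≤lx x∈Q with em {l ∙ x ≈ 0#}
    ... | yes lx≈0 = convex-resp (hull-convex wedge)
      (λ { zero → ≤-antisym 0≤t (≤-respʳ lx≈0 t≤lx) ; (suc j) → refl }) (bottom∈wedge x∈Q)
    ... | no  lx≉0 with reciprocal (nonneg∧≉0⇒positive (≤-trans 0≤t t≤lx) lx≉0)
    ...   | r , (0≤r , _) , lx*r≈1 = hull-convex wedge (r * (l ∙ x - t)) (r * t)
      (*-nonneg 0≤r (x≤y⇒0≤y-x t≤lx)) (*-nonneg 0≤r 0≤t) weights (bottom∈wedge x∈Q)
        (top∈wedge x∈Q) λ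
      { zero → begin
          t                 ≈⟨ *-identityʳ t ⟨
          t * 1#            ≈⟨ *-congˡ lx*r≈1 ⟨
          t * (l ∙ x * r)
            ≈⟨ solve 4 (λ r u t w → t :* (u :* r)
              := r :* (u :- t) :* con (0 , 0) :+ r :* t :* u) refl r (l ∙ x) t t ⟩
          r * (l ∙ x - t) * 0# + r * t * (l ∙ x) ∎
      ; (suc j) → trans (sym (*-identityˡ (x j)))
            (trans (*-congʳ (sym weights)) (distribʳ (x j) _ _))
      }
      where
      weights : r * (l ∙ x - t) + r * t ≈ 1#
      weights = trans (solve 3 (λ r u t → r :* (u :- t) :+ r :* t
        := u :* r) refl r (l ∙ x) t) lx*r≈1

    wedge-describes : Describes wedge wedge-height wedge-bounds
    wedge-describes = record
      { height   = hull-least (hyperplane-convex wedge-height 1#) wedge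
          (Allₚ.++⁺ (λ x → wedge-height ∙ x ≈ 1#)
            (λ i → trans (0∷-∙ η 0# (q i)) (height (vertex∈hull q i)))
            (λ i → trans (0∷-∙ η (l ∙ q i) (q i)) (height (vertex∈hull q i))))
      ; bounded  = λ x∈ i → hull-least (halfspace-convex (wedge-bounds i) 0#) wedge
          (Allₚ.++⁺ (λ x → 0# ≤ wedge-bounds i ∙ x)
            (λ k → wedge-bounded i ≤-refl (l≥0 k) (vertex∈hull q k))
            (λ k → wedge-bounded i (l≥0 k) ≤-refl (vertex∈hull q k))) x∈
      ; complete = wedge-complete
      }
      where
      wedge-complete : ∀ {y} → wedge-height ∙ y ≈ 1# → (∀ i → 0# ≤ wedge-bounds i ∙ y) →
        y ∈ Hull wedge
      wedge-complete {y} ηy≈1 νy≥0 =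
        convex-resp (hull-convex wedge) (λ { zero → refl ; (suc j) → refl })
        (segment∈wedge {y zero} {y ∘ suc}
          (≤-respʳ (1∷0-∙ (y zero) (y ∘ suc)) (νy≥0 zero))
          (0≤y-x⇒x≤y (≤-respʳ (-1∷-∙ l (y zero) (y ∘ suc)) (νy≥0 (suc zero))))
          (complete (trans (sym (0∷-∙ η (y zero) (y ∘ suc))) ηy≈1)
            (λ i → ≤-respʳ (0∷-∙ (ν i) (y zero) (y ∘ suc)) (νy≥0 (suc (suc i))))))

  -- The projection is constrained on generators only, each lying over a vertex with a known index.
  -- The mirror step can then be followed index by index; hulls return in `lift-isExtension`.
  record Lift (p : ℕ → Point R 2) (k m : ℕ) : Set where
    field
      {dimension}  : ℕ
      {count}      : ℕ
      q            : Vector (Point R dimension) count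
      η            : Point R dimension
      ν            : Vector (Point R dimension) m
      describes    : Describes q η ν
      π            : LinearMap R dimension 2
      over         : ∀ i → ∃[ j ] (j ℕ.< k × apply R π (q i) ≋ p j)
      onto         : ∀ {j} → j ℕ.< k → ∃[ i ] apply R π (q i) ≋ p j

  -- The point 1 of the real line is cut out by the height equation alone, so no inequality is
  -- spent.
  lift-point : ∀ p → Lift p 1 0
  lift-point p = record
    { q         = ones
    ; η         = one
    ; ν         = λ ()
    ; describes = record
      { height   = hull-least (hyperplane-convex one 1#) ones (λ _ → one∙one)
      ; bounded  = λ _ ()
      ; complete = λ {x} ηx≈1 _ → convex-resp (hull-convex ones)
          (λ { zero → trans (sym ηx≈1) (trans (+-identityʳ _) (*-identityˡ _)) })
            (vertex∈hull ones zero)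
      }
    ; π         = λ r _ → p 0 r
    ; over      = λ _ → 0 , ℕ.s≤s ℕ.z≤n , λ r → over-p₀ r
    ; onto      = λ { {zero} _ → zero , over-p₀ ; {suc _} (ℕ.s≤s ()) }
    }
    where
    one : Point R 1
    one _ = 1#
    ones : Vector (Point R 1) 1
    ones _ = one
    one∙one : one ∙ one ≈ 1#
    one∙one = trans (+-identityʳ _) (*-identityʳ 1#)
    over-p₀ : ∀ r → (λ (_ : Fin 1) → p 0 r) ∙ one ≈ p 0 r
    over-p₀ r = trans (+-identityʳ _) (*-identityʳ _)

  affine : Point R 3 → Point R 2 → Carrier
  affine l y = l 0F + (l 1F * y 0F + l (suc 1F) * y 1F)

  affine-cong : ∀ l {x y} → x ≋ y → affine l x ≈ affine l y
  affine-cong l x≋y = +-congˡ (+-cong (*-congˡ (x≋y 0F)) (*-congˡ (x≋y 1F)))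

  -- Records the reflection y ↦ y + l y a through its effect on vertices of the first half, which is
  -- all that the wedge over that half sees.
  record Mirror (p : ℕ → Point R 2) (N : ℕ) : Set where
    field
      direction : Point R 2
      l         : Point R 3
      nonneg    : ∀ {i j} → i ℕ.+ j ≡ N → i ℕ.≤ j → 0# ≤ affine l (p i)
      reflect   : ∀ {i j} → i ℕ.+ j ≡ N → i ℕ.≤ j → ∀ r →
        p j r ≈ p i r + affine l (p i) * direction r

  ∙-linearˡ : ∀ {d} s t {f g h : Point R d} x → (∀ j → h j ≈ s * f j + t * g j) →
              h ∙ x ≈ s * (f ∙ x) + t * (g ∙ x)
  ∙-linearˡ s t {f} {g} {h} x h≈ = begin
    h ∙ x                     ≈⟨ ∙-comm h x ⟩
    x ∙ h                     ≈⟨ ∙-linearʳ s t x h≈ ⟩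
    s * (x ∙ f) + t * (x ∙ g) ≈⟨ +-cong (*-congˡ (∙-comm x f)) (*-congˡ (∙-comm x g)) ⟩
    s * (f ∙ x) + t * (g ∙ x) ∎

  -- The two bounds say that k = ⌈(N + 1) / 2⌉. The first gives i ≤ N - i for i < k, so every lifted
  -- vertex has its mirror image ahead; the second gives N - j < k for j ≥ k, so every new vertex is
  -- such an image.
  lift-mirror : ∀ {p k m N} → Lift p k m → Mirror p N → k ℕ.+ k ℕ.≤ suc (suc N) → N ℕ.< k ℕ.+ k →
                Lift p (suc N) (2 ℕ.+ m)
  lift-mirror {p} {k} {m} {N} lift mirror 2k≤N+2 N<2k = record
    { q         = wedge describes functional functional≥0
    ; η         = wedge-height describes functional functional≥0
    ; ν         = wedge-bounds describes functional functional≥0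
    ; describes = wedge-describes describes functional functional≥0
    ; π         = π′
    ; over      = Allₚ.++⁺ (λ x → ∃[ j ] (j ℕ.< suc N × apply R π′ x ≋ p j)) over-bottom over-top
    ; onto      = onto′
    }
    where
    open Lift lift
    open Mirror mirror

    linear : Point R dimension
    linear j = l 1F * π 0F j + l (suc 1F) * π 1F j
    -- The constant term of the affine function becomes a multiple of `η`, which is 1 on Q; so its
    -- pullback is a linear form there.
    functional : Point R dimension
    functional j = l 0F * η j + 1# * linear j
    functional-value : ∀ {x} → x ∈ Hull q → functional ∙ x ≈ affine l (apply R π x)
    functional-value {x} x∈Q = trans (∙-linearˡ (l 0F) 1# {η} {linear} x (λ _ → refl)) (+-cong
      (trans (*-congˡ (Describes.height describes x∈Q)) (*-identityʳ _))
      (trans (*-identityˡ _) (∙-linearˡ (l 1F) (l (suc 1F)) {π 0F} {π 1F} x (λ _ → refl))))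

    -- This sends (t , x) to π x + t a: the bottom copy of Q stays in place and the top copy is
    -- moved onto the mirror image.
    π′ : LinearMap R (suc dimension) 2
    π′ r = direction r Vector.∷ π r

    partner : ∀ {i} → i ℕ.< k → ∃[ j ] (i ℕ.+ j ≡ N × i ℕ.≤ j)
    partner {i} i<k = N ℕ.∸ i , ℕₚ.m+[n∸m]≡n (ℕₚ.m+n≤o⇒m≤o i i+i≤N) ,
      ℕₚ.m+n≤o⇒m≤o∸n i i+i≤N
      where
      i+i≤N : i ℕ.+ i ℕ.≤ N
      i+i≤N = ℕ.s≤s⁻¹ (ℕ.s≤s⁻¹ (ℕₚ.≤-trans (ℕₚ.≤-reflexive (≡.cong suc (≡.sym (ℕₚ.+-suc i i))))
        (ℕₚ.≤-trans (ℕₚ.+-mono-≤ i<k i<k) 2k≤N+2)))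

    value-over : ∀ i {j} → apply R π (q i) ≋ p j → functional ∙ q i ≈ affine l (p j)
    value-over i over = trans (functional-value (vertex∈hull q i)) (affine-cong l over)

    functional≥0 : ∀ i → 0# ≤ functional ∙ q i
    functional≥0 i with over i
    ... | j , j<k , over-j with partner j<k
    ...   | j′ , j+j′≡N , j≤j′ = ≤-respʳ (sym (value-over i over-j)) (nonneg j+j′≡N j≤j′)

    bottom-image : ∀ i → apply R π′ (0# Vector.∷ q i) ≋ apply R π (q i)
    bottom-image i r = trans (+-congʳ (zeroʳ (direction r))) (+-identityˡ _)

    top-image : ∀ i {j j′} → apply R π (q i) ≋ p j → j ℕ.+ j′ ≡ N → j ℕ.≤ j′ →
                apply R π′ ((functional ∙ q i) Vector.∷ q i) ≋ p j′
    top-image i {j} {j′} over-j j+j′≡N j≤j′ r = begin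
      direction r * (functional ∙ q i) + apply R π (q i) r
        ≈⟨ +-cong (*-congˡ (value-over i over-j)) (over-j r) ⟩
      direction r * affine l (p j) + p j r                 ≈⟨ +-comm _ _ ⟩
      p j r + direction r * affine l (p j)                 ≈⟨ +-congˡ (*-comm _ _) ⟩
      p j r + affine l (p j) * direction r                 ≈⟨ reflect j+j′≡N j≤j′ r ⟨
      p j′ r                                               ∎

    over-bottom : ∀ i → ∃[ j ] (j ℕ.< suc N × apply R π′ (0# Vector.∷ q i) ≋ p j)
    over-bottom i with over i
    ... | j , j<k , over-j with partner j<k
    ...   | j′ , ≡.refl , _ = j , ℕ.s≤s (ℕₚ.m≤m+n j j′) , λ r → trans (bottom-image i r) (over-j r)

    over-top : ∀ i → ∃[ j ] (j ℕ.< suc N × apply R π′ ((functional ∙ q i) Vector.∷ q i) ≋ p j)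
    over-top i with over i
    ... | j , j<k , over-j with partner j<k
    ...   | j′ , j+j′≡N , j≤j′ = j′ , ℕ.s≤s (ℕₚ.≤-trans (ℕₚ.m≤n+m j′ j) (ℕₚ.≤-reflexive j+j′≡N)) ,
      top-image i over-j j+j′≡N j≤j′

    onto′ : ∀ {j} → j ℕ.< suc N →
      ∃[ i ] apply R π′ (wedge describes functional functional≥0 i) ≋ p j
    onto′ {j} (ℕ.s≤s j≤N) with j ℕₚ.<? k
    ... | yes j<k with onto j<k
    ...   | i , over-j = i Fin.↑ˡ _ , λ r → trans
      (reflexive (≡.cong (λ x → apply R π′ x r) (bottom describes functional functional≥0 i)))
      (trans (bottom-image i r) (over-j r))
    onto′ {j} (ℕ.s≤s j≤N) | no j≮k with onto {N ℕ.∸ j} N∸j<k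
      where
      k≤j = ℕₚ.≮⇒≥ j≮k
      N∸j<k : N ℕ.∸ j ℕ.< k
      N∸j<k = ℕₚ.+-cancelʳ-< j _ _ (ℕₚ.≤-trans (ℕ.s≤s (ℕₚ.≤-reflexive (ℕₚ.m∸n+n≡m j≤N)))
        (ℕₚ.≤-trans N<2k (ℕₚ.+-monoʳ-≤ k k≤j)))
    ...   | i , over-j′ = count Fin.↑ʳ i , λ r → trans
      (reflexive (≡.cong (λ x → apply R π′ x r) (top describes functional functional≥0 i)))
      (top-image i over-j′ (ℕₚ.m∸n+n≡m j≤N)
        (ℕₚ.m≤n+o⇒m∸n≤o N j (ℕₚ.≤-trans (ℕₚ.<⇒≤ N<2k) (ℕₚ.+-mono-≤ (ℕₚ.≮⇒≥ j≮k) (ℕₚ.≮⇒≥ j≮k)))) r)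

  -- Images and preimages of convex sets under `π` are convex, so by `hull-least` both inclusions
  -- reduce to the generators.
  lift-isExtension : ∀ {n m} {p : ℕ → Point R 2} (lift : Lift p n m) (v : Vector (Point R 2) n) →
    (∀ i → v i ≋ p (Fin.toℕ i)) → (P : Polytope R 2) → ⟦_⟧ R P ≐ Hull v →
    IsExtension R (record { generators = Lift.q lift }) P
  lift-isExtension {n} {p = p} lift v v≋p P (P⊆v , v⊆P) = π ,
    (λ {y} y∈P → hull-least image-convex v v∈image (P⊆v {y} y∈P)) ,
    λ {y} (x , x∈Q , πx≋y) → v⊆P {y}
      (convex-resp (hull-convex v) πx≋y (hull-least preimage-convex q q∈preimage x∈Q))
    where
    open Lift lift

    image-convex : Convex (Image R π (Hull q))
    image-convex s t 0≤s 0≤t s+t≈1 (x , x∈Q , πx≋) (y , y∈Q , πy≋) z≈ =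
      (λ j → s * x j + t * y j) , hull-convex q s t 0≤s 0≤t s+t≈1 x∈Q y∈Q (λ _ → refl) ,
      λ r → trans (∙-linearʳ s t (π r) (λ _ → refl))
        (trans (+-cong (*-congˡ (πx≋ r)) (*-congˡ (πy≋ r))) (sym (z≈ r)))

    preimage-convex : Convex (λ x → apply R π x ∈ Hull v)
    preimage-convex s t 0≤s 0≤t s+t≈1 x∈ y∈ z≈ =
      hull-convex v s t 0≤s 0≤t s+t≈1 x∈ y∈ (λ r → ∙-linearʳ s t (π r) z≈)

    v∈image : ∀ i → v i ∈ Image R π (Hull q)
    v∈image i with onto (Finₚ.toℕ<n i)
    ... | k , πq≋p = q k , vertex∈hull q k , λ r → trans (πq≋p r) (sym (v≋p i r))

    q∈preimage : ∀ i → apply R π (q i) ∈ Hull v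
    q∈preimage i with over i
    ... | j , j<n , πq≋p = convex-resp (hull-convex v) (λ r → begin
      v (Fin.fromℕ< j<n) r             ≈⟨ v≋p _ r ⟩
      p (Fin.toℕ (Fin.fromℕ< j<n)) r   ≡⟨ ≡.cong (λ k → p k r) (Finₚ.toℕ-fromℕ< j<n) ⟩
      p j r                            ≈⟨ πq≋p r ⟨
      apply R π (q i) r                ∎) (vertex∈hull v (Fin.fromℕ< j<n))

-- Reflections from a rotating sequence of edges.

module RegularSequences (em : ExcludedMiddle 0ℓ) (R : Reals) where
  open Reals R hiding (zero)
  open CommutativeRingSolver commutativeRing
  open OrderedField em R
  open Convexity em R
  open Lifting em R
  open SetoidReasoning setoid

  edge : (ℕ → Point R 2) → ℕ → Point R 2
  edge p i = _⊖_ R (p (suc i)) (p i)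

  cross-positive⇒nonzeroˡ : ∀ (u v : Point R 2) → 0# < cross R u v → ¬ (u 0F ≈ 0# × u 1F ≈ 0#)
  cross-positive⇒nonzeroˡ u v 0<uv (u₀≈0 , u₁≈0) = positive⇒nonzero 0<uv (begin
    u 0F * v 1F - u 1F * v 0F ≈⟨ +-cong (*-congʳ u₀≈0) (-‿cong (*-congʳ u₁≈0)) ⟩
    0# * v 1F - 0# * v 0F
      ≈⟨ solve 2 (λ a b → con (0 , 0) :* a :- con (0 , 0) :* b := con (0 , 0)) refl (v 1F) (v 0F) ⟩
    0#                        ∎)

  cross-positive⇒nonzeroʳ : ∀ (u v : Point R 2) → 0# < cross R u v → ¬ (v 0F ≈ 0# × v 1F ≈ 0#)
  cross-positive⇒nonzeroʳ u v 0<uv (v₀≈0 , v₁≈0) = positive⇒nonzero 0<uv (begin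
    u 0F * v 1F - u 1F * v 0F ≈⟨ +-cong (*-congˡ v₁≈0) (-‿cong (*-congˡ v₀≈0)) ⟩
    u 0F * 0# - u 1F * 0#
      ≈⟨ solve 2 (λ a b → a :* con (0 , 0) :- b :* con (0 , 0) := con (0 , 0)) refl (u 0F) (u 1F) ⟩
    0#                        ∎)

  norm-positive : ∀ (u : Point R 2) → ¬ (u 0F ≈ 0# × u 1F ≈ 0#) → 0# < u 0F * u 0F + u 1F * u 1F
  norm-positive u u≉0 = nonneg∧≉0⇒positive (+-nonneg (square-nonneg _) (square-nonneg _)) λ uu≈0 →
    u≉0 (square≈0⇒≈0 (nonneg-sum-zeroˡ (square-nonneg _) (square-nonneg _) uu≈0) ,
         square≈0⇒≈0 (nonneg-sum-zeroˡ (square-nonneg _) (square-nonneg _)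
           (trans (+-comm _ _) uu≈0)))

  -- The rotation law holds at all indices, so that inductions never wrap around. Convexity is
  -- confined to the first `n` indices, where distinct indices mean distinct vertices.
  record RegularSequence (n : ℕ) (p : ℕ → Point R 2) : Set where
    field
      α β     : Carrier
      unit    : α * α + β * β ≈ 1#
      0<β     : 0# < β
      rotate₀ : ∀ i → edge p (suc i) 0F ≈ α * edge p i 0F - β * edge p i 1F
      rotate₁ : ∀ i → edge p (suc i) 1F ≈ β * edge p i 0F + α * edge p i 1F
      convex  : ∀ {i j} → suc i ℕ.< n → j ℕ.< n → j ≢ i → j ≢ suc i →
                0# < cross R (edge p i) (_⊖_ R (p j) (p i))

    RotatesAbout : Point R 2 → Set
    RotatesAbout c = ∀ i →
      p (suc i) 0F - c 0F ≈ α * (p i 0F - c 0F) - β * (p i 1F - c 1F) ×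
      p (suc i) 1F - c 1F ≈ β * (p i 0F - c 0F) + α * (p i 1F - c 1F)

  |ω-1|² : Carrier → Carrier → Carrier
  |ω-1|² α β = (α - 1#) * (α - 1#) + β * β

  -- With ω = α + i β, the displacement z = x + i y solves (ω - 1) z = e + i f.
  displacement : ∀ {α β g} e f → |ω-1|² α β * g ≈ 1# →
                 ∃[ x ] ∃[ y ] (e + x ≈ α * x - β * y × f + y ≈ β * x + α * y)
  displacement {α} {β} {g} e f inverse =
    ((α - 1#) * e + β * f) * g , ((α - 1#) * f - β * e) * g ,
    trans (+-congʳ (insert e)) (identity₀ α β g e f) ,
      trans (+-congʳ (insert f)) (identity₁ α β g e f)
    where
    insert : ∀ e → e ≈ |ω-1|² α β * g * e
    insert e = sym (trans (*-congʳ inverse) (*-identityˡ e))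
    identity₀ : ∀ α β g e f → |ω-1|² α β * g * e + ((α - 1#) * e + β * f) * g ≈
                α * (((α - 1#) * e + β * f) * g) - β * (((α - 1#) * f - β * e) * g)
    identity₀ = solve 5 (λ α β g e f →
      ((α :- con (1 , 0)) :* (α :- con (1 , 0)) :+ β :* β) :* g :* e
        :+ ((α :- con (1 , 0)) :* e :+ β :* f) :* g :=
      α :* (((α :- con (1 , 0)) :* e :+ β :* f) :* g) :- β
        :* (((α :- con (1 , 0)) :* f :- β :* e) :* g)) refl
    identity₁ : ∀ α β g e f → |ω-1|² α β * g * f + ((α - 1#) * f - β * e) * g ≈
                β * (((α - 1#) * e + β * f) * g) + α * (((α - 1#) * f - β * e) * g)
    identity₁ = solve 5 (λ α β g e f →
      ((α :- con (1 , 0)) :* (α :- con (1 , 0)) :+ β :* β) :* g :* f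
        :+ ((α :- con (1 , 0)) :* f :- β :* e) :* g :=
      β :* (((α :- con (1 , 0)) :* e :+ β :* f) :* g) :+ α
        :* (((α :- con (1 , 0)) :* f :- β :* e) :* g)) refl

  -- The real part of r - c = (r - q) + (q - c) = ω (q - p) + ω (p - c) = ω (q - c); `telescope₁` is
  -- the imaginary part.
  telescope₀ : ∀ {α β p₀ p₁ q₀ q₁ r₀} c₀ c₁ → r₀ - q₀ ≈ α * (q₀ - p₀) - β * (q₁ - p₁) →
               q₀ - c₀ ≈ α * (p₀ - c₀) - β * (p₁ - c₁) → r₀ - c₀ ≈ α * (q₀ - c₀) - β * (q₁ - c₁)
  telescope₀ {α} {β} {p₀} {p₁} {q₀} {q₁} {r₀} c₀ c₁ step before = begin
    r₀ - c₀                 ≈⟨ solve 3 (λ r q c → r :- c := (r :- q) :+ (q :- c)) refl r₀ q₀ c₀ ⟩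
    (r₀ - q₀) + (q₀ - c₀)   ≈⟨ +-cong step before ⟩
    (α * (q₀ - p₀) - β * (q₁ - p₁)) + (α * (p₀ - c₀) - β * (p₁ - c₁))
      ≈⟨ solve 8 (λ α β p₀ p₁ q₀ q₁ c₀ c₁ →
        (α :* (q₀ :- p₀) :- β :* (q₁ :- p₁)) :+ (α :* (p₀ :- c₀) :- β :* (p₁ :- c₁))
          := α :* (q₀ :- c₀) :- β :* (q₁ :- c₁))
           refl α β p₀ p₁ q₀ q₁ c₀ c₁ ⟩
    α * (q₀ - c₀) - β * (q₁ - c₁) ∎

  telescope₁ : ∀ {α β p₀ p₁ q₀ q₁ r₁} c₀ c₁ → r₁ - q₁ ≈ β * (q₀ - p₀) + α * (q₁ - p₁) →
               q₁ - c₁ ≈ β * (p₀ - c₀) + α * (p₁ - c₁) → r₁ - c₁ ≈ β * (q₀ - c₀) + α * (q₁ - c₁)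
  telescope₁ {α} {β} {p₀} {p₁} {q₀} {q₁} {r₁} c₀ c₁ step before = begin
    r₁ - c₁                 ≈⟨ solve 3 (λ r q c → r :- c := (r :- q) :+ (q :- c)) refl r₁ q₁ c₁ ⟩
    (r₁ - q₁) + (q₁ - c₁)   ≈⟨ +-cong step before ⟩
    (β * (q₀ - p₀) + α * (q₁ - p₁)) + (β * (p₀ - c₀) + α * (p₁ - c₁))
      ≈⟨ solve 8 (λ α β p₀ p₁ q₀ q₁ c₀ c₁ →
        (β :* (q₀ :- p₀) :+ α :* (q₁ :- p₁)) :+ (β :* (p₀ :- c₀) :+ α :* (p₁ :- c₁))
          := β :* (q₀ :- c₀) :+ α :* (q₁ :- c₁))
           refl α β p₀ p₁ q₀ q₁ c₀ c₁ ⟩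
    β * (q₀ - c₀) + α * (q₁ - c₁) ∎

  module _ {n p} (regular : RegularSequence n p) where
    open RegularSequence regular

    centre-at : ∀ {x y} → edge p 0 0F + x ≈ α * x - β * y → edge p 0 1F + y ≈ β * x + α * y →
      ∃[ c ] RotatesAbout c
    centre-at {x} {y} x-fixed y-fixed = centre , rotates
      where
      centre : Point R 2
      centre 0F = p 0 0F - x
      centre 1F = p 0 1F - y
      u-[u-x]≈x : ∀ u x → u - (u - x) ≈ x
      u-[u-x]≈x = solve 2 (λ u x → u :- (u :- x) := x) refl
      v-[u-x]≈v-u+x : ∀ v u x → v - (u - x) ≈ (v - u) + x
      v-[u-x]≈v-u+x = solve 3 (λ v u x → v :- (u :- x) := (v :- u) :+ x) refl
      rotates : RotatesAbout centre
      rotates zero = (begin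
          p 1 0F - centre 0F ≈⟨ v-[u-x]≈v-u+x (p 1 0F) (p 0 0F) x ⟩
          edge p 0 0F + x    ≈⟨ x-fixed ⟩
          α * x - β * y
            ≈⟨ +-cong (*-congˡ (u-[u-x]≈x (p 0 0F) x)) (-‿cong (*-congˡ (u-[u-x]≈x (p 0 1F) y))) ⟨
          α * (p 0 0F - centre 0F) - β * (p 0 1F - centre 1F) ∎) , (begin
          p 1 1F - centre 1F ≈⟨ v-[u-x]≈v-u+x (p 1 1F) (p 0 1F) y ⟩
          edge p 0 1F + y    ≈⟨ y-fixed ⟩
          β * x + α * y
            ≈⟨ +-cong (*-congˡ (u-[u-x]≈x (p 0 0F) x)) (*-congˡ (u-[u-x]≈x (p 0 1F) y)) ⟨
          β * (p 0 0F - centre 0F) + α * (p 0 1F - centre 1F) ∎)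
      rotates (suc i) =
        telescope₀ (centre 0F) (centre 1F) (rotate₀ i) (proj₁ (rotates i)) ,
        telescope₁ (centre 0F) (centre 1F) (rotate₁ i) (proj₂ (rotates i))

    -- The centre is p₀ - z, where (ω - 1) z is the first edge. This is solvable because β > 0 makes
    -- |ω - 1|² positive.
    centre-exists : ∃[ c ] RotatesAbout c
    centre-exists = from-reciprocal
      (reciprocal (+-nonneg-positive (square-nonneg (α - 1#)) (*-positive 0<β 0<β)))
      where
      from-reciprocal : ∃[ g ] (0# < g × |ω-1|² α β * g ≈ 1#) → ∃[ c ] RotatesAbout c
      from-reciprocal (g , _ , inverse) =
        from-displacement (displacement (edge p 0 0F) (edge p 0 1F) inverse)
        where
        from-displacement : ∃[ x ] ∃[ y ] (edge p 0 0F + x ≈ α * x - β * y ×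
                                           edge p 0 1F + y ≈ β * x + α * y) →
                            ∃[ c ] RotatesAbout c
        from-displacement (x , y , x-fixed , y-fixed) = centre-at x-fixed y-fixed

  module _ {n p} (regular : RegularSequence n p) (centre : Point R 2)
           (rotation : RegularSequence.RotatesAbout regular centre) where
    open RegularSequence regular

    X Y : ℕ → Carrier
    X i = p i 0F - centre 0F
    Y i = p i 1F - centre 1F

    X-suc : ∀ i → X (suc i) ≈ α * X i - β * Y i
    X-suc i = proj₁ (rotation i)

    Y-suc : ∀ i → Y (suc i) ≈ β * X i + α * Y i
    Y-suc i = proj₂ (rotation i)

    equidistant : ∀ i → X i * X i + Y i * Y i ≈ X 0 * X 0 + Y 0 * Y 0
    equidistant zero    = refl
    equidistant (suc i) = begin
      X (suc i) * X (suc i) + Y (suc i) * Y (suc i)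
        ≈⟨ +-cong (*-cong (X-suc i) (X-suc i)) (*-cong (Y-suc i) (Y-suc i)) ⟩
      (α * X i - β * Y i) * (α * X i - β * Y i) + (β * X i + α * Y i) * (β * X i + α * Y i)
        ≈⟨ solve 4 (λ α β x y → (α :* x :- β :* y) :* (α :* x :- β :* y) :+ (β :* x :+ α :* y)
          :* (β :* x :+ α :* y) := (α :* α :+ β :* β) :* (x :* x :+ y :* y)) refl α β (X i) (Y i) ⟩
      (α * α + β * β) * (X i * X i + Y i * Y i) ≈⟨ trans (*-congʳ unit) (*-identityˡ _) ⟩
      X i * X i + Y i * Y i ≈⟨ equidistant i ⟩
      X 0 * X 0 + Y 0 * Y 0 ∎

    module _ (N : ℕ) (1≤N : 1 ℕ.≤ N) (N<n : N ℕ.< n) (3≤n : 3 ℕ.≤ n) where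

      chord : Point R 2
      chord = _⊖_ R (p N) (p 0)

      private
        a₀ = chord 0F
        a₁ = chord 1F

      -- The inner and cross products of p i - centre with the chord, that is, its coordinates along
      -- and perpendicular to the chord, both scaled by the length of the chord.
      along across : ℕ → Carrier
      along  i = X i * a₀ + Y i * a₁
      across i = X i * a₁ - Y i * a₀

      along-suc : ∀ i → along (suc i) ≈ α * along i + β * across i
      along-suc i = trans (+-cong (*-congʳ (X-suc i)) (*-congʳ (Y-suc i)))
        (solve 6 (λ α β x y a b → (α :* x :- β :* y) :* a :+ (β :* x :+ α :* y) :* b
          := α :* (x :* a :+ y :* b) :+ β :* (x :* b :- y :* a)) refl α β (X i) (Y i) a₀ a₁)

      across-suc : ∀ i → across (suc i) ≈ α * across i - β * along i
      across-suc i = trans (+-cong (*-congʳ (X-suc i)) (-‿cong (*-congʳ (Y-suc i))))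
        (solve 6 (λ α β x y a b → (α :* x :- β :* y) :* b :- (β :* x :+ α :* y) :* a
          := α :* (x :* b :- y :* a) :- β :* (x :* a :+ y :* b)) refl α β (X i) (Y i) a₀ a₁)

      -- Induction from the outside in. The endpoints are mirror images because they are equidistant
      -- from the centre; then i advances by ω while j retreats by its inverse, and a reflection
      -- turns the one rotation into the other.
      mirrored : ∀ i j → i ℕ.+ j ≡ N → along i ≈ - along j × across i ≈ across j
      mirrored zero    j ≡.refl = (begin
          X 0 * a₀ + Y 0 * a₁
            ≈⟨ solve 6 (λ u v p q c d → (p :- c) :* (u :- p) :+ (q :- d) :* (v :- q) :=
                 :- ((u :- c) :* (u :- p) :+ (v :- d) :* (v :- q))
                   :+ (((u :- c) :* (u :- c) :+ (v :- d) :* (v :- d))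
                     :- ((p :- c) :* (p :- c) :+ (q :- d) :* (q :- d))))
                 refl (p N 0F) (p N 1F) (p 0 0F) (p 0 1F) (centre 0F) (centre 1F) ⟩
          - along N + ((X N * X N + Y N * Y N) - (X 0 * X 0 + Y 0 * Y 0))
            ≈⟨ +-congˡ (trans (+-congʳ (equidistant N)) (-‿inverseʳ _)) ⟩
          - along N + 0# ≈⟨ +-identityʳ _ ⟩
          - along N ∎) ,
        solve 6 (λ u v p q c d → (p :- c) :* (v :- q) :- (q :- d) :* (u :- p)
          := (u :- c) :* (v :- q) :- (v :- d) :* (u :- p))
          refl (p N 0F) (p N 1F) (p 0 0F) (p 0 1F) (centre 0F) (centre 1F)
      mirrored (suc i) j i+j≡N = (begin
          along (suc i)                                  ≈⟨ along-suc i ⟩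
          α * along i + β * across i
            ≈⟨ +-cong (*-congˡ (trans along≈ (-‿cong (along-suc j))))
              (*-congˡ (trans across≈ (across-suc j))) ⟩
          α * - (α * along j + β * across j) + β * (α * across j - β * along j)
            ≈⟨ solve 4 (λ α β d c → α :* :- (α :* d :+ β :* c) :+ β :* (α :* c :- β :* d)
              := (α :* α :+ β :* β) :* :- d) refl α β (along j) (across j) ⟩
          (α * α + β * β) * - along j                    ≈⟨ trans (*-congʳ unit) (*-identityˡ _) ⟩
          - along j                                      ∎) , (begin
          across (suc i)                                 ≈⟨ across-suc i ⟩
          α * across i - β * along i
            ≈⟨ +-cong (*-congˡ (trans across≈ (across-suc j)))
              (-‿cong (*-congˡ (trans along≈ (-‿cong (along-suc j))))) ⟩
          α * (α * across j - β * along j) - β * - (α * along j + β * across j)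
            ≈⟨ solve 4 (λ α β d c → α :* (α :* c :- β :* d) :- β :* :- (α :* d :+ β :* c)
              := (α :* α :+ β :* β) :* c) refl α β (along j) (across j) ⟩
          (α * α + β * β) * across j                     ≈⟨ trans (*-congʳ unit) (*-identityˡ _) ⟩
          across j                                       ∎)
        where
        along≈  = proj₁ (mirrored i (suc j) (≡.trans (ℕₚ.+-suc i j) i+j≡N))
        across≈ = proj₂ (mirrored i (suc j) (≡.trans (ℕₚ.+-suc i j) i+j≡N))

      -- A vertex strictly to the left of the first edge differs from p 0. For N = 1 the chord is
      -- that edge itself, and the third vertex shows that it is nonzero.
      chord-nonzero : ¬ (a₀ ≈ 0# × a₁ ≈ 0#)
      chord-nonzero with N ℕₚ.≟ 1
      ... | yes ≡.refl = cross-positive⇒nonzeroˡ (edge p 0) (_⊖_ R (p 2) (p 0))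
            (convex {0} {2} N<n 3≤n (λ ()) (λ ()))
      ... | no  N≢1    = cross-positive⇒nonzeroʳ (edge p 0) chord
            (convex {0} {N} (ℕₚ.≤-<-trans 1≤N N<n) N<n
        (λ N≡0 → ℕₚ.<⇒≢ 1≤N (≡.sym N≡0)) N≢1)

      module Scale (h : Carrier) (h-inverse : (a₀ * a₀ + a₁ * a₁) * h ≈ 1#) where

        -- With h = 1 / |a|², this is y ↦ - 2 h (y - centre) ∙ a, the coefficient of a in the
        -- reflection across the line through the centre perpendicular to the chord.
        scale : Point R 3
        scale 0F = h * (centre 0F * a₀ + centre 1F * a₁) + h * (centre 0F * a₀ + centre 1F * a₁)
        scale 1F = - (h * a₀ + h * a₀)
        scale 2F = - (h * a₁ + h * a₁)

        scale-value : ∀ i → affine scale (p i) ≈ - (h * along i + h * along i)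
        scale-value i = solve 7 (λ h x y c d a b →
          (h :* (c :* a :+ d :* b) :+ h :* (c :* a :+ d :* b))
            :+ (:- (h :* a :+ h :* a) :* x :+ :- (h :* b :+ h :* b) :* y)
            := :- (h :* ((x :- c) :* a :+ (y :- d) :* b) :+ h :* ((x :- c) :* a :+ (y :- d) :* b)))
          refl h (p i 0F) (p i 1F) (centre 0F) (centre 1F) a₀ a₁

        -- Expand p j - p i in the orthogonal basis of the chord and its quarter turn. By `mirrored`
        -- the second component vanishes and the first is - 2 h times `along i`.
        reflect : ∀ {i j} → i ℕ.+ j ≡ N → ∀ r → p j r ≈ p i r + affine scale (p i) * chord r
        reflect {i} {j} i+j≡N r = begin
          p j r
            ≈⟨ solve 2 (λ u v → v := u :+ con (1 , 0) :* (v :- u)) refl (p i r) (p j r) ⟩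
          p i r + 1# * (p j r - p i r)            ≈⟨ +-congˡ (*-congʳ h-inverse) ⟨
          p i r + (a₀ * a₀ + a₁ * a₁) * h * (p j r - p i r) ≈⟨ +-congˡ (decompose r) ⟩
          p i r + (h * (along j - along i) * chord r + h * (across j - across i) * turned r)
            ≈⟨ +-congˡ (+-cong (*-congʳ (*-congˡ (+-congʳ along-j≈)))
              (*-congʳ (*-congˡ (trans (+-congʳ (sym across≈)) (-‿inverseʳ _))))) ⟩
          p i r + (h * (- along i - along i) * chord r + h * 0# * turned r)
            ≈⟨ solve 5 (λ u h d c t → u :+ (h :* (:- d :- d) :* c :+ h :* con (0 , 0) :* t)
              := u :+ :- (h :* d :+ h :* d) :* c)
                 refl (p i r) h (along i) (chord r) (turned r) ⟩
          p i r + - (h * along i + h * along i) * chord r ≈⟨ +-congˡ (*-congʳ (scale-value i)) ⟨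
          p i r + affine scale (p i) * chord r ∎
          where
          along≈ = proj₁ (mirrored i j i+j≡N)
          across≈ = proj₂ (mirrored i j i+j≡N)
          along-j≈ : along j ≈ - along i
          along-j≈ = trans (solve 1 (λ d → d := :- :- d) refl (along j)) (-‿cong (sym along≈))
          turned : Point R 2
          turned 0F = a₁
          turned 1F = - a₀
          decompose : ∀ r → (a₀ * a₀ + a₁ * a₁) * h * (p j r - p i r) ≈
                      h * (along j - along i) * chord r + h * (across j - across i) * turned r
          decompose 0F = solve 9 (λ h x y u v c d a b →
              (a :* a :+ b :* b) :* h :* (u :- x) :=
              h :* (((u :- c) :* a :+ (v :- d) :* b) :- ((x :- c) :* a :+ (y :- d) :* b)) :* a :+
              h :* (((u :- c) :* b :- (v :- d) :* a) :- ((x :- c) :* b :- (y :- d) :* a)) :* b)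
            refl h (p i 0F) (p i 1F) (p j 0F) (p j 1F) (centre 0F) (centre 1F) a₀ a₁
          decompose 1F = solve 9 (λ h x y u v c d a b →
              (a :* a :+ b :* b) :* h :* (v :- y) :=
              h :* (((u :- c) :* a :+ (v :- d) :* b) :- ((x :- c) :* a :+ (y :- d) :* b)) :* b :+
              h :* (((u :- c) :* b :- (v :- d) :* a) :- ((x :- c) :* b :- (y :- d) :* a)) :* :- a)
            refl h (p i 0F) (p i 1F) (p j 0F) (p j 1F) (centre 0F) (centre 1F) a₀ a₁

        -- The reflection moves p 0 by exactly one chord, since `along N - along 0` is |a|². This
        -- value starts the induction on signs.
        scale-start : affine scale (p 0) ≈ 1#
        scale-start = begin
          affine scale (p 0)                ≈⟨ scale-value 0 ⟩
          - (h * along 0 + h * along 0)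
            ≈⟨ -‿cong (+-congˡ (*-congˡ (proj₁ (mirrored 0 N ≡.refl)))) ⟩
          - (h * along 0 + h * - along N)
            ≈⟨ solve 9 (λ h x y u v c d a b →
                 :- (h :* ((x :- c) :* a :+ (y :- d) :* b) :+ h
                   :* :- ((u :- c) :* a :+ (v :- d) :* b)) :=
                 ((u :- x) :* a :+ (v :- y) :* b) :* h)
                 refl h (p 0 0F) (p 0 1F) (p N 0F) (p N 1F) (centre 0F) (centre 1F) a₀ a₁ ⟩
          (a₀ * a₀ + a₁ * a₁) * h           ≈⟨ h-inverse ⟩
          1#                                ∎

        turn : ℕ → Carrier
        turn i = cross R (edge p i) chord

        -- Both p j and p (j + 1) lie to the left of the edge from p i to
        -- p (i + 1), which gives turn i the sign of the scales at i and at i + 1.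
        scale-positive : ∀ i j → i ℕ.+ j ≡ N → i ℕ.< j → 0# < affine scale (p i)
        scale-positive zero    j i+j≡N i<j = <-respʳ (sym scale-start) 0<1
        scale-positive (suc i) j i+j≡N i<j =
          positive-factor (proj₁ 0<turn) (<-respʳ inner inner-left)
          where
          i+sj≡N : i ℕ.+ suc j ≡ N
          i+sj≡N = ≡.trans (ℕₚ.+-suc i j) i+j≡N
          i<sj : i ℕ.< suc j
          i<sj = ℕₚ.≤-trans (ℕₚ.n≤1+n _) (ℕₚ.≤-trans i<j (ℕₚ.n≤1+n j))
          sj<n : suc j ℕ.< n
          sj<n = ℕₚ.≤-<-trans (ℕₚ.m+n≤o⇒n≤o i (ℕₚ.≤-reflexive i+sj≡N)) N<n
          si<n : suc i ℕ.< n
          si<n = ℕₚ.<-trans i<j (ℕₚ.<-trans (ℕₚ.n<1+n j) sj<n)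
          outer-left = convex si<n sj<n (ℕₚ.>⇒≢ i<sj) (ℕₚ.>⇒≢ (ℕₚ.m≤n⇒m≤1+n i<j))
          inner-left = convex si<n (ℕₚ.<-trans (ℕₚ.n<1+n j) sj<n)
            (ℕₚ.>⇒≢ (ℕₚ.<-trans (ℕₚ.n<1+n i) i<j)) (ℕₚ.>⇒≢ i<j)

          outer : cross R (edge p i) (_⊖_ R (p (suc j)) (p i)) ≈ affine scale (p i) * turn i
          outer = begin
            edge p i 0F * (p (suc j) 1F - p i 1F) - edge p i 1F * (p (suc j) 0F - p i 0F)
              ≈⟨ +-cong (*-congˡ (+-congʳ (reflect i+sj≡N 1F)))
                (-‿cong (*-congˡ (+-congʳ (reflect i+sj≡N 0F)))) ⟩
            edge p i 0F * (p i 1F + t * a₁ - p i 1F) - edge p i 1F * (p i 0F + t * a₀ - p i 0F)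
              ≈⟨ solve 7 (λ e f x y t a b → e :* (y :+ t :* b :- y) :- f :* (x :+ t :* a :- x)
                := t :* (e :* b :- f :* a))
                   refl (edge p i 0F) (edge p i 1F) (p i 0F) (p i 1F) t a₀ a₁ ⟩
            t * turn i ∎
            where t = affine scale (p i)

          inner : cross R (edge p i) (_⊖_ R (p j) (p i)) ≈ turn i * affine scale (p (suc i))
          inner = begin
            edge p i 0F * (p j 1F - p i 1F) - edge p i 1F * (p j 0F - p i 0F)
              ≈⟨ +-cong (*-congˡ (+-congʳ (reflect i+j≡N 1F)))
                (-‿cong (*-congˡ (+-congʳ (reflect i+j≡N 0F)))) ⟩
            edge p i 0F * (p (suc i) 1F + t * a₁ - p i 1F) - edge p i 1F
              * (p (suc i) 0F + t * a₀ - p i 0F)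
              ≈⟨ solve 7 (λ x y u v t a b →
                   (u :- x) :* (v :+ t :* b :- y) :- (v :- y) :* (u :+ t :* a :- x)
                     := ((u :- x) :* b :- (v :- y) :* a) :* t)
                   refl (p i 0F) (p i 1F) (p (suc i) 0F) (p (suc i) 1F) t a₀ a₁ ⟩
            turn i * t ∎
            where t = affine scale (p (suc i))

          0<turn : 0# < turn i
          0<turn = positive-factor (proj₁ (scale-positive i (suc j) i+sj≡N i<sj))
            (<-respʳ outer outer-left)

        scale-nonneg : ∀ {i j} → i ℕ.+ j ≡ N → i ℕ.≤ j → 0# ≤ affine scale (p i)
        scale-nonneg {i} {j} i+j≡N i≤j with ℕₚ.m≤n⇒m<n∨m≡n i≤j
        ... | inj₁ i<j    = proj₁ (scale-positive i j i+j≡N i<j)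
        ... | inj₂ ≡.refl = ≤-reflexive (begin
          0#
            ≈⟨ solve 2 (λ h d → con (0 , 0) := :- (h :* (:- d :+ d))) refl h (along i) ⟩
          - (h * (- along i + along i)) ≈⟨ -‿cong (*-congˡ (+-congʳ (proj₁ (mirrored i i i+j≡N)))) ⟨
          - (h * (along i + along i))   ≈⟨ -‿cong (distribˡ h _ _) ⟩
          - (h * along i + h * along i) ≈⟨ scale-value i ⟨
          affine scale (p i)            ∎)

        mirror : Mirror p N
        mirror = record
          { direction = chord
          ; l         = scale
          ; nonneg    = scale-nonneg
          ; reflect   = λ i+j≡N _ → reflect i+j≡N
          }

  mirror-exists : ∀ {n p N} → RegularSequence n p → 1 ℕ.≤ N → N ℕ.< n → 3 ℕ.≤ n → Mirror p N
  mirror-exists {n} {p} {N} regular 1≤N N<n 3≤n = from-centre (centre-exists regular)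
    where
    from-centre : ∃[ c ] RegularSequence.RotatesAbout regular c → Mirror p N
    from-centre (c , rotation) =
      from-reciprocal (reciprocal
        (norm-positive (chord regular c rotation N 1≤N N<n 3≤n)
          (chord-nonzero regular c rotation N 1≤N N<n 3≤n)))
      where
      a = chord regular c rotation N 1≤N N<n 3≤n
      from-reciprocal : ∃[ h ] (0# < h × (a 0F * a 0F + a 1F * a 1F) * h ≈ 1#) → Mirror p N
      from-reciprocal (h , _ , inverse) = Scale.mirror regular c rotation N 1≤N N<n 3≤n h inverse

-- Cyclic indices as residues.

module _ {n-1 : ℕ} where
  private
    n = suc n-1

  toℕ-mod : ∀ k → Fin.toℕ (k mod n) ≡ k % n
  toℕ-mod k = Finₚ.toℕ-fromℕ< (m%n<n k n)

  next-mod : ∀ k → next (k mod n) ≡ suc k mod n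
  next-mod k = Finₚ.toℕ-injective (begin
    Fin.toℕ (next (k mod n))         ≡⟨ toℕ-mod (suc (Fin.toℕ (k mod n))) ⟩
    suc (Fin.toℕ (k mod n)) % n      ≡⟨ ≡.cong (λ i → suc i % n) (toℕ-mod k) ⟩
    suc (k % n) % n                  ≡⟨ %-distribˡ-+ 1 (k % n) n ⟩
    (1 % n ℕ.+ k % n % n) % n        ≡⟨ ≡.cong (λ i → (1 % n ℕ.+ i) % n) (m%n%n≡m%n k n) ⟩
    (1 % n ℕ.+ k % n) % n            ≡⟨ %-distribˡ-+ 1 k n ⟨
    suc k % n                        ≡⟨ toℕ-mod (suc k) ⟨
    Fin.toℕ (suc k mod n)            ∎)
    where open ≡.≡-Reasoning

  mod-small-injective : ∀ {i j} → i ℕ.< n → j ℕ.< n → i mod n ≡ j mod n → i ≡ j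
  mod-small-injective {i} {j} i<n j<n eq = begin
    i                   ≡⟨ m<n⇒m%n≡m i<n ⟨
    i % n               ≡⟨ toℕ-mod i ⟨
    Fin.toℕ (i mod n)   ≡⟨ ≡.cong Fin.toℕ eq ⟩
    Fin.toℕ (j mod n)   ≡⟨ toℕ-mod j ⟩
    j % n               ≡⟨ m<n⇒m%n≡m j<n ⟩
    j                   ∎
    where open ≡.≡-Reasoning

  -- Without wrapping, the sum exceeds r. With wrapping, it falls to d + r - n, which is below r
  -- because d < n.
  residue-moves : ∀ {r d} → r ℕ.< n → 0 ℕ.< d → d ℕ.< n → (d ℕ.+ r) % n ≢ r
  residue-moves {r} {d} r<n 0<d d<n eq with d ℕ.+ r ℕₚ.<? n
  ... | yes d+r<n = ℕₚ.<⇒≢ (ℕₚ.m<n+m r 0<d) (≡.sym (≡.trans (≡.sym (m<n⇒m%n≡m d+r<n)) eq))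
  ... | no  d+r≮n = ℕₚ.<⇒≢ e<r
        (≡.trans (≡.sym e%n≡e) (≡.trans (≡.sym ([m+n]%n≡m%n e n))
          (≡.trans (≡.cong (_% n) e+n≡d+r) eq)))
    where
    e = (d ℕ.+ r) ℕ.∸ n
    e+n≡d+r : e ℕ.+ n ≡ d ℕ.+ r
    e+n≡d+r = ℕₚ.m∸n+n≡m (ℕₚ.≮⇒≥ d+r≮n)
    e<r : e ℕ.< r
    e<r = ℕₚ.+-cancelʳ-< n e r (≡.subst (ℕ._< r ℕ.+ n) (≡.sym e+n≡d+r)
      (≡.subst (d ℕ.+ r ℕ.<_) (ℕₚ.+-comm n r) (ℕₚ.+-monoˡ-< r d<n)))
    e%n≡e : e % n ≡ e
    e%n≡e = m<n⇒m%n≡m (ℕₚ.<-trans e<r r<n)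

  mod-moves : ∀ k {d} → 0 ℕ.< d → d ℕ.< n → (d ℕ.+ k) mod n ≢ k mod n
  mod-moves k {d} 0<d d<n eq = residue-moves (m%n<n k n) 0<d d<n (begin
    (d ℕ.+ k % n) % n             ≡⟨ %-distribˡ-+ d (k % n) n ⟩
    (d % n ℕ.+ k % n % n) % n     ≡⟨ ≡.cong (λ i → (d % n ℕ.+ i) % n) (m%n%n≡m%n k n) ⟩
    (d % n ℕ.+ k % n) % n         ≡⟨ %-distribˡ-+ d k n ⟨
    (d ℕ.+ k) % n                 ≡⟨ toℕ-mod (d ℕ.+ k) ⟨
    Fin.toℕ ((d ℕ.+ k) mod n)     ≡⟨ ≡.cong Fin.toℕ eq ⟩
    Fin.toℕ (k mod n)             ≡⟨ toℕ-mod k ⟩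
    k % n                         ∎)
    where open ≡.≡-Reasoning

-- From equal sides and angles to a rotation.

module RegularPolygons (em : ExcludedMiddle 0ℓ) (R : Reals) where
  open Reals R hiding (zero)
  open CommutativeRingSolver commutativeRing
  open OrderedField em R
  open Convexity em R
  open RegularSequences em R
  open SetoidReasoning setoid

  -- The vector u and its quarter turn form an orthogonal basis, so v is determined by its inner and
  -- cross products with u. This is the real part of v = (- c + i s g) u, and `rotated₁` is the
  -- imaginary part.
  rotated₀ : ∀ {u₀ u₁ v₀ v₁ L g c s} → u₀ * u₀ + u₁ * u₁ ≈ L → L * g ≈ 1# →
             u₀ * v₀ + u₁ * v₁ ≈ - (c * L) → u₀ * v₁ - u₁ * v₀ ≈ s → v₀ ≈ - c * u₀ - s * g * u₁
  rotated₀ {u₀} {u₁} {v₀} {v₁} {L} {g} {c} {s} uu≈L Lg≈1 uv≈ cross≈ = begin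
    v₀                                 ≈⟨ *-identityˡ v₀ ⟨
    1# * v₀                            ≈⟨ *-congʳ (trans (*-congʳ uu≈L) Lg≈1) ⟨
    (u₀ * u₀ + u₁ * u₁) * g * v₀
      ≈⟨ solve 5 (λ a b x y g → (a :* a :+ b :* b) :* g :* x
        := g :* ((a :* x :+ b :* y) :* a :- (a :* y :- b :* x) :* b)) refl u₀ u₁ v₀ v₁ g ⟩
    g * ((u₀ * v₀ + u₁ * v₁) * u₀ - (u₀ * v₁ - u₁ * v₀) * u₁)
      ≈⟨ *-congˡ (+-cong (*-congʳ uv≈) (-‿cong (*-congʳ cross≈))) ⟩
    g * (- (c * L) * u₀ - s * u₁)
      ≈⟨ solve 6 (λ a b g c l s → g :* (:- (c :* l) :* a :- s :* b)
        := :- c :* a :* (l :* g) :- s :* g :* b) refl u₀ u₁ g c L s ⟩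
    - c * u₀ * (L * g) - s * g * u₁    ≈⟨ +-congʳ (trans (*-congˡ Lg≈1) (*-identityʳ _)) ⟩
    - c * u₀ - s * g * u₁              ∎

  rotated₁ : ∀ {u₀ u₁ v₀ v₁ L g c s} → u₀ * u₀ + u₁ * u₁ ≈ L → L * g ≈ 1# →
             u₀ * v₀ + u₁ * v₁ ≈ - (c * L) → u₀ * v₁ - u₁ * v₀ ≈ s → v₁ ≈ s * g * u₀ + - c * u₁
  rotated₁ {u₀} {u₁} {v₀} {v₁} {L} {g} {c} {s} uu≈L Lg≈1 uv≈ cross≈ = begin
    v₁                                 ≈⟨ *-identityˡ v₁ ⟨
    1# * v₁                            ≈⟨ *-congʳ (trans (*-congʳ uu≈L) Lg≈1) ⟨
    (u₀ * u₀ + u₁ * u₁) * g * v₁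
      ≈⟨ solve 5 (λ a b x y g → (a :* a :+ b :* b) :* g :* y
        := g :* ((a :* x :+ b :* y) :* b :+ (a :* y :- b :* x) :* a)) refl u₀ u₁ v₀ v₁ g ⟩
    g * ((u₀ * v₀ + u₁ * v₁) * u₁ + (u₀ * v₁ - u₁ * v₀) * u₀)
      ≈⟨ *-congˡ (+-cong (*-congʳ uv≈) (*-congʳ cross≈)) ⟩
    g * (- (c * L) * u₁ + s * u₀)
      ≈⟨ solve 6 (λ a b g c l s → g :* (:- (c :* l) :* b :+ s :* a)
        := s :* g :* a :+ :- c :* b :* (l :* g)) refl u₀ u₁ g c L s ⟩
    s * g * u₀ + - c * u₁ * (L * g)    ≈⟨ +-congˡ (trans (*-congˡ Lg≈1) (*-identityʳ _)) ⟩
    s * g * u₀ + - c * u₁              ∎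

  module _ {n-1 : ℕ} (3≤n : 3 ℕ.≤ suc n-1)
           (v : Vector (Point R 2) (suc n-1)) (v-convex : IsConvexPolygon R v)
           (ℓ² : Carrier)
           (equilateral : ∀ i → _⊖_ R (v (next i)) (v i) ∙ _⊖_ R (v (next i)) (v i) ≈ ℓ²)
           (c : Carrier)
           (equiangular : ∀ i → HasCosine R (_⊖_ R (v i) (v (next i)))
                                            (_⊖_ R (v (next (next i))) (v (next i))) c)
           where
    private
      n = suc n-1

    -- The periodic extension makes the step from the last vertex to the first an ordinary
    -- successor.
    vertex : ℕ → Point R 2
    vertex k = v (k mod n)

    vertex-toℕ : ∀ i → v i ≋ vertex (Fin.toℕ i)
    vertex-toℕ i r = reflexive (≡.cong (λ k → v k r)
      (Finₚ.toℕ-injective (≡.sym (≡.trans (toℕ-mod (Fin.toℕ i)) (m<n⇒m%n≡m (Finₚ.toℕ<n i))))))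

    length : ∀ k → edge vertex k 0F * edge vertex k 0F + edge vertex k 1F * edge vertex k 1F ≈ ℓ²
    length k = trans (+-congˡ (sym (+-identityʳ _)))
      (≡.subst (λ i → let e = _⊖_ R (v i) (vertex k) in e ∙ e
        ≈ ℓ²) (next-mod k) (equilateral (k mod n)))

    turning : ℕ → Carrier
    turning k = cross R (edge vertex k) (edge vertex (suc k))

    -- Convexity is applied to the vertex k + 2; replacing its start p k by p (k + 1) changes the
    -- cross product by that of an edge with itself. As n ≥ 3, the three vertices are distinct.
    turning-positive : ∀ k → 0# < turning k
    turning-positive k = <-respʳ
      (solve 6 (λ a b p q x y → (p :- a) :* (y :- b) :- (q :- b) :* (x :- a)
        := (p :- a) :* (y :- q) :- (q :- b) :* (x :- p)) refl
        (vertex k 0F) (vertex k 1F) (vertex (suc k) 0F) (vertex (suc k) 1F)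
          (vertex (suc (suc k)) 0F) (vertex (suc (suc k)) 1F))
      (≡.subst (λ i → 0# < cross R (_⊖_ R (v i) (vertex k))
        (_⊖_ R (vertex (suc (suc k))) (vertex k))) (next-mod k)
        (v-convex (k mod n) (suc (suc k) mod n)
          (mod-moves k (ℕ.s≤s ℕ.z≤n) 3≤n)
          (λ eq → mod-moves (suc k) (ℕ.s≤s ℕ.z≤n) (ℕₚ.≤-trans (ℕₚ.n≤1+n 2) 3≤n)
            (≡.trans eq (next-mod k)))))

    ℓ²-positive : 0# < ℓ²
    ℓ²-positive = <-respʳ (length 0) (norm-positive (edge vertex 0)
      (cross-positive⇒nonzeroˡ (edge vertex 0) (edge vertex 1) (turning-positive 0)))

    cosine : ∀ k → HasCosine R (_⊖_ R (vertex k) (vertex (suc k)))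
      (_⊖_ R (vertex (suc (suc k))) (vertex (suc k))) c
    cosine k = ≡.subst (λ i →
      HasCosine R (_⊖_ R (vertex k) (vertex (suc k))) (_⊖_ R (v i) (vertex (suc k))) c)
        (next-mod (suc k))
      (≡.subst (λ i → HasCosine R (_⊖_ R (vertex k) (v i)) (_⊖_ R (v (next i)) (v i)) c)
        (next-mod k) (equiangular (k mod n)))

    -- The cosine belongs to the interior angle, between the reversed edge and the next one, hence
    -- the sign. Its length factor s is ℓ², both being nonnegative with square ℓ⁴.
    inner-product : ∀ k →
      edge vertex k 0F * edge vertex (suc k) 0F + edge vertex k 1F * edge vertex (suc k) 1F ≈
      - (c * ℓ²)
    inner-product k = from-cosine (cosine k)
      where
      u = _⊖_ R (vertex k) (vertex (suc k))
      w = edge vertex (suc k)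
      from-cosine : HasCosine R u w c →
        edge vertex k 0F * w 0F + edge vertex k 1F * w 1F ≈ - (c * ℓ²)
      from-cosine (s , 0≤s , s²≈ , uw≈cs) = begin
        edge vertex k 0F * w 0F + edge vertex k 1F * w 1F
          ≈⟨ solve 6 (λ a b x y p q → (x :- a) :* p :+ (y :- b) :* q
            := :- ((a :- x) :* p :+ ((b :- y) :* q :+ con (0 , 0)))) refl
               (vertex k 0F) (vertex k 1F) (vertex (suc k) 0F) (vertex (suc k) 1F) (w 0F) (w 1F) ⟩
        - (u ∙ w)  ≈⟨ -‿cong uw≈cs ⟩
        - (c * s)  ≈⟨ -‿cong (*-congˡ (square-injective 0≤s (proj₁ ℓ²-positive) s²≈ℓ⁴)) ⟩
        - (c * ℓ²) ∎
        where
        uu≈ℓ² : u ∙ u ≈ ℓ²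
        uu≈ℓ² = trans (solve 4 (λ a b x y →
          (a :- x) :* (a :- x) :+ ((b :- y) :* (b :- y) :+ con (0 , 0))
            := (x :- a) :* (x :- a) :+ (y :- b) :* (y :- b)) refl
          (vertex k 0F) (vertex k 1F) (vertex (suc k) 0F) (vertex (suc k) 1F)) (length k)
        s²≈ℓ⁴ : s * s ≈ ℓ² * ℓ²
        s²≈ℓ⁴ = trans s²≈ (*-cong uu≈ℓ² (trans (+-congˡ (+-identityʳ _)) (length (suc k))))

    -- Lagrange's identity: the squares of the cross and inner products of two vectors sum to the
    -- product of their squared lengths.
    turning-square : ∀ k → turning k * turning k ≈ ℓ² * ℓ² - (c * ℓ²) * (c * ℓ²)
    turning-square k = begin
      turning k * turning k
        ≈⟨ solve 4 (λ a b x y → (a :* y :- b :* x) :* (a :* y :- b :* x)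
          := (a :* a :+ b :* b) :* (x :* x :+ y :* y) :- :- (a :* x :+ b :* y)
            :* :- (a :* x :+ b :* y)) refl
             (edge vertex k 0F) (edge vertex k 1F) (edge vertex (suc k) 0F)
               (edge vertex (suc k) 1F) ⟩
      _ ≈⟨ +-cong (*-cong (length k) (length (suc k))) (-‿cong (*-cong negated negated)) ⟩
      ℓ² * ℓ² - (c * ℓ²) * (c * ℓ²) ∎
      where
      negated : - (edge vertex k 0F * edge vertex (suc k) 0F + edge vertex k 1F
        * edge vertex (suc k) 1F) ≈ c * ℓ²
      negated = trans (-‿cong (inner-product k)) (solve 1 (λ x → :- :- x := x) refl (c * ℓ²))

    -- The cosine determines the sine up to sign, and convexity makes it positive at every vertex.
    turning-constant : ∀ k → turning k ≈ turning 0
    turning-constant k = square-injective (proj₁ (turning-positive k)) (proj₁ (turning-positive 0))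
      (trans (turning-square k) (sym (turning-square 0)))

    regularSequence : RegularSequence n vertex
    regularSequence = from-reciprocal (reciprocal ℓ²-positive)
      where
      from-reciprocal : ∃[ g ] (0# < g × ℓ² * g ≈ 1#) → RegularSequence n vertex
      from-reciprocal (g , 0<g , ℓ²g≈1) = record
        -- These are the cosine and sine of the exterior angle, with g = 1 / ℓ².
        { α       = - c
        ; β       = turning 0 * g
        ; unit    = begin
            - c * - c + (turning 0 * g) * (turning 0 * g)
              ≈⟨ solve 3 (λ c s g → :- c :* :- c :+ (s :* g) :* (s :* g)
                := c :* c :+ (s :* s) :* (g :* g)) refl c (turning 0) g ⟩
            c * c + (turning 0 * turning 0) * (g * g) ≈⟨ +-congˡ (*-congʳ (turning-square 0)) ⟩
            c * c + (ℓ² * ℓ² - (c * ℓ²) * (c * ℓ²)) * (g * g)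
              ≈⟨ solve 3 (λ c l g → c :* c :+ (l :* l :- (c :* l) :* (c :* l)) :* (g :* g)
                := c :* c :+ (con (1 , 0) :- c :* c) :* ((l :* g) :* (l :* g))) refl c ℓ² g ⟩
            c * c + (1# - c * c) * ((ℓ² * g) * (ℓ² * g)) ≈⟨ +-congˡ (*-congˡ (*-cong ℓ²g≈1 ℓ²g≈1)) ⟩
            c * c + (1# - c * c) * (1# * 1#)
              ≈⟨ solve 1 (λ d → d :+ (con (1 , 0) :- d) :* (con (1 , 0) :* con (1 , 0))
                := con (1 , 0)) refl (c * c) ⟩
            1# ∎
        ; 0<β     = *-positive (turning-positive 0) 0<g
        ; rotate₀ = λ i → rotated₀ (length i) ℓ²g≈1 (inner-product i) (turning-constant i)
        ; rotate₁ = λ i → rotated₁ (length i) ℓ²g≈1 (inner-product i) (turning-constant i)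
        ; convex  = convex
        }
        where
        convex : ∀ {i j} → suc i ℕ.< n → j ℕ.< n → j ≢ i → j ≢ suc i →
                 0# < cross R (edge vertex i) (_⊖_ R (vertex j) (vertex i))
        convex {i} {j} si<n j<n j≢i j≢si =
          ≡.subst (λ k → 0# < cross R (_⊖_ R (v k) (vertex i)) (_⊖_ R (vertex j) (vertex i)))
            (next-mod i)
            (v-convex (i mod n) (j mod n)
              (λ eq → j≢i (mod-small-injective j<n (ℕₚ.<-trans (ℕₚ.n<1+n i) si<n) eq))
              (λ eq → j≢si (mod-small-injective j<n si<n (≡.trans eq (next-mod i)))))

-- Halving and the logarithmic bound.

open import Data.Nat.Base using (_≤_; _<_; _*_)

⌈n/2⌉≤1+⌊n/2⌋ : ∀ n → ℕ.⌈ n /2⌉ ≤ suc ℕ.⌊ n /2⌋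
⌈n/2⌉≤1+⌊n/2⌋ n = ℕₚ.⌊n/2⌋-mono (ℕₚ.n≤1+n (suc n))

n<2^[1+⌊log₂n⌋] : ∀ n → n < 2 ℕ.^ suc ⌊log₂ n ⌋
n<2^[1+⌊log₂n⌋] n = ℕₚ.≰⇒> λ 2^≤n → ℕₚ.1+n≰n
  (≡.subst (_≤ ⌊log₂ n ⌋) (⌊log₂[2^n]⌋≡n (suc ⌊log₂ n ⌋)) (⌊log₂⌋-mono-≤ 2^≤n))

-- The left side counts two inequalities for each of at most 1 + l halvings and the added one of
-- `facet-count`. The constant 3 is absorbed by 3 l, whence the 5.
1+2[1+l]≤5l : ∀ {l} → 1 ≤ l → suc (suc l * 2) ≤ 5 * l
1+2[1+l]≤5l {l} 1≤l = begin
  3 ℕ.+ l * 2   ≤⟨ ℕₚ.+-mono-≤ (ℕₚ.*-monoʳ-≤ 3 1≤l) (ℕₚ.≤-reflexive (ℕₚ.*-comm l 2)) ⟩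
  3 * l ℕ.+ 2 * l ≡⟨ ℕₚ.*-distribʳ-+ l 3 2 ⟨
  5 * l         ∎
  where open ℕₚ.≤-Reasoning

module RegularPolygonComplexity (em : ExcludedMiddle 0ℓ) (R : Reals) where
  open Enumeration em
  open FacetCount em R
  open Lifting em R
  open RegularSequences em R
  open RegularPolygons em R

  -- The recursion is on the last index N of the window. Its first half ends at ⌊N / 2⌋ and has ⌊N /
  -- 2⌋ + 1 = ⌈(N + 1) / 2⌉ vertices, as `lift-mirror` requires.
  lift-window : ∀ {n p} → RegularSequence n p → 3 ≤ n → ∀ d N → N < n → N < 2 ℕ.^ d →
                ∃[ m ] (m ≤ d * 2 × Lift p (suc N) m)
  lift-window {p = p} regular 3≤n d       zero    N<n N<2^d = 0 , ℕ.z≤n , lift-point p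
  lift-window         regular 3≤n zero    (suc N) N<n (ℕ.s≤s ())
  lift-window         regular 3≤n (suc d) (suc N) N<n N<2^d
    with lift-window regular 3≤n d ℕ.⌊ suc N /2⌋ (ℕₚ.≤-<-trans (ℕₚ.⌊n/2⌋≤n (suc N)) N<n) half<2^d
    where
    half<2^d : ℕ.⌊ suc N /2⌋ < 2 ℕ.^ d
    half<2^d = ℕₚ.≰⇒> λ 2^d≤half → ℕₚ.<⇒≱ N<2^d (begin
      2 ℕ.^ d ℕ.+ (2 ℕ.^ d ℕ.+ 0)               ≡⟨ ≡.cong (2 ℕ.^ d ℕ.+_) (ℕₚ.+-identityʳ _) ⟩
      2 ℕ.^ d ℕ.+ 2 ℕ.^ d
        ≤⟨ ℕₚ.+-mono-≤ 2^d≤half (ℕₚ.≤-trans 2^d≤half (ℕₚ.⌊n/2⌋≤⌈n/2⌉ (suc N))) ⟩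
      ℕ.⌊ suc N /2⌋ ℕ.+ ℕ.⌈ suc N /2⌉           ≡⟨ ℕₚ.⌊n/2⌋+⌈n/2⌉≡n (suc N) ⟩
      suc N                                     ∎)
      where open ℕₚ.≤-Reasoning
  ... | m , m≤2d , lift = 2 ℕ.+ m , ℕ.s≤s (ℕ.s≤s m≤2d) ,
    lift-mirror lift (mirror-exists regular (ℕ.s≤s ℕ.z≤n) N<n 3≤n) lower upper
    where
    open ℕₚ.≤-Reasoning
    k = ℕ.⌊ suc N /2⌋
    lower : suc k ℕ.+ suc k ≤ suc (suc (suc N))
    lower = begin
      suc (k ℕ.+ suc k)                  ≡⟨ ≡.cong suc (ℕₚ.+-suc k k) ⟩
      2 ℕ.+ (k ℕ.+ k)
        ≤⟨ ℕₚ.+-monoʳ-≤ 2 (ℕₚ.+-monoʳ-≤ k (ℕₚ.⌊n/2⌋≤⌈n/2⌉ (suc N))) ⟩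
      2 ℕ.+ (k ℕ.+ ℕ.⌈ suc N /2⌉)        ≡⟨ ≡.cong (2 ℕ.+_) (ℕₚ.⌊n/2⌋+⌈n/2⌉≡n (suc N)) ⟩
      suc (suc (suc N))                  ∎
    upper : suc N < suc k ℕ.+ suc k
    upper = begin
      suc (suc N)                        ≡⟨ ≡.cong suc (ℕₚ.⌊n/2⌋+⌈n/2⌉≡n (suc N)) ⟨
      suc (k ℕ.+ ℕ.⌈ suc N /2⌉)          ≤⟨ ℕₚ.+-monoʳ-≤ (suc k) (⌈n/2⌉≤1+⌊n/2⌋ (suc N)) ⟩
      suc k ℕ.+ suc k                    ∎

  extension-of-size : ∀ n → 3 ≤ n → (P : Polytope R 2) → IsRegularPolygon R n P →
                      ∃[ k ] (k ≤ 5 * ⌊log₂ n ⌋ × HasExtensionOfSize R P k)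
  extension-of-size n@(suc n-1) 3≤n P (v , v-convex , (ℓ² , equilateral) , (c , equiangular) ,
    P≐v) =
    from-lift (lift-window (regularSequence 3≤n v v-convex ℓ² equilateral c equiangular) 3≤n
      (suc ⌊log₂ n ⌋) n-1 ℕₚ.≤-refl (ℕₚ.<⇒≤ (n<2^[1+⌊log₂n⌋] n)))
    where
    p : ℕ → Point R 2
    p = vertex 3≤n v v-convex ℓ² equilateral c equiangular
    from-lift : ∃[ m ] (m ≤ suc ⌊log₂ n ⌋ * 2 × Lift p n m) →
      ∃[ k ] (k ≤ 5 * ⌊log₂ n ⌋ × HasExtensionOfSize R P k)
    from-lift (m , m≤ , lift) = from-count (facet-count (Lift.describes lift))
      where
      Q : Polytope R (Lift.dimension lift)
      Q = record { generators = Lift.q lift }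
      from-count : ∃[ k ] (k ≤ suc m × HasSize R Q k) →
        ∃[ k ] (k ≤ 5 * ⌊log₂ n ⌋ × HasExtensionOfSize R P k)
      from-count (k , k≤1+m , size) = k ,
        ℕₚ.≤-trans k≤1+m (ℕₚ.≤-trans (ℕ.s≤s m≤) (1+2[1+l]≤5l (⌊log₂⌋-mono-≤ 3≤n))) ,
        Lift.dimension lift , Q ,
        lift-isExtension lift v (vertex-toℕ 3≤n v v-convex ℓ² equilateral c equiangular) P P≐v ,
          size

  extension-complexity : ∀ n → 3 ≤ n → (P : Polytope R 2) → IsRegularPolygon R n P →
                         ∃[ m ] (IsExtensionComplexity R P m × m ≤ 5 * ⌊log₂ n ⌋)
  extension-complexity n 3≤n P regular = from-extension (extension-of-size n 3≤n P regular)
    where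
    from-extension : ∃[ k ] (k ≤ 5 * ⌊log₂ n ⌋ × HasExtensionOfSize R P k) →
                     ∃[ m ] (IsExtensionComplexity R P m × m ≤ 5 * ⌊log₂ n ⌋)
    from-extension (k , k≤ , extension) with least (HasExtensionOfSize R P) (5 * ⌊log₂ n ⌋) k≤
      extension
    ... | m , m≤ , m-extension , minimal = m , (m-extension , minimal) , m≤

-- As ⌊log₂ n⌋ ≤ log₂ n, the bound with the integer part implies the one with the real logarithm;
-- another base only changes the constant.
theorem2 : ∃[ C ] (0 < C × (ExcludedMiddle 0ℓ → (R : Reals) (n : ℕ) → 3 ≤ n →
    (P : Polytope R 2) → IsRegularPolygon R n P →
    ∃[ m ] (IsExtensionComplexity R P m × m ≤ C * ⌊log₂ n ⌋)))
theorem2 = 5 , ℕ.s≤s ℕ.z≤n , λ em R n 3≤n P regular →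
  RegularPolygonComplexity.extension-complexity em R n 3≤n P regular
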